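{- For every $n\ge1$, $c_3(n)\equiv c_6(n)\equiv c_{12}(n)\pmod 2$. Moreover: (1) $c_3(2n)\equiv 0\pmod 2$ for all $n\ge1$, and $c_3(4n+1)\equiv c_3(12n+7)\equiv c_3(24n+11)\equiv 0\pmod 2$ for all $n\ge 0$. (2) For every $n\ge1$, $c_3(24n-1)\equiv c_{f_3}(n)\equiv c_{\phi_3}(n)\equiv c_{\phi_6}(n)\equiv c_{2\mu_6}(2n)\equiv p(n)\pmod 2$. (3) For every $n\ge1$, $c_3(24n-9)\equiv c_{\psi_6}(n)\pmod 2$. (4) For $n\ge 0$, $c_3(24n+3)\equiv 1\pmod 2$ if and only if $n=\frac{k(k+1)}{2}$ for some integer $k\ge 0$. (5) For every $n\ge0$, $c_3(12n+3)\equiv c_{\lambda_6}(n)\pmod 2$.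
   Context: Let $q=e^{2\pi i\tau}$, $(a,q)_n=\prod_{k=0}^{n-1}(1-aq^k)$, $(q)_n=(q,q)_n$, with the obvious infinite versions; $\eta_k=q^{k/24}(q^k)_\infty$. Define $j_3=\eta_1^{12}/\eta_3^{12}$, $j_6=\eta_2^3\eta_3^9/(\eta_1^3\eta_6^9)$, $j_{12}=\eta_4^4\eta_6^2/(\eta_2^2\eta_{12}^4)$. Each has an expansion $j_N(\tau)=q^{ -1}+a_N+\sum_{n\ge1}c_N(n)q^n$, and $c_N(n)$ denotes the $n$-th Fourier coefficient. For a $q$-series $f(q)$, $c_f(n)$ is the coefficient of $q^n$ in $f$; $p(n)$ is the number of partitions of $n$. The mock theta functions are $f_3(q)=\sum_{n\ge0}\frac{q^{n^2}}{(-q,q)_n^2}$, $\phi_3(q)=\sum_{n\ge0}\frac{q^{n^2}}{(-q^2,q^2)_n}$ (3rd order); $\phi_6(q)=\sum_{n\ge0}\frac{(-1)^n(q,q^2)_nq^{n^2}}{(-q,q)_{2n}}$, $\psi_6(q)=\sum_{n\ge0}\frac{(-1)^nq^{(n+1)^2}(q,q^2)_n}{(-q,q)_{2n+1}}$, $\lambda_6(q)=\sum_{n\ge0}\frac{(-1)^nq^n(q,q^2)_n}{(-q,q)_n}$, $2\mu_6(q)=1+\sum_{n\ge0}\frac{(-1)^nq^{n+1}(1+q^n)(q,q^2)_n}{(-q,q)_{n+1}}$ (6th order); $c_{2\mu_6}(m)$ is the coefficient of $q^m$ in $2\mu_6(q)$. -}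

module Defs where

open import Data.Nat as ℕ using (ℕ; zero; suc; _∸_; _≤ᵇ_)
open import Data.Nat.DivMod using (_/_; _%_)
open import Data.Integer as ℤ using (ℤ; +_; -_; _-_; 0ℤ; 1ℤ; -1ℤ)
open import Data.Integer.Divisibility using (_∣_)
open import Data.List using (List; []; _∷_; map; upTo; foldr)
open import Data.Nat.ListAction using (sum)
open import Data.Bool using (if_then_else_)

-- Formal power series in q with integer coefficients: n ↦ coeff of q^n

Series : Set
Series = ℕ → ℤ

sumTo : ℕ → (ℕ → ℤ) → ℤ
sumTo zero    f = f zero
sumTo (suc n) f = sumTo n f ℤ.+ f (suc n)

δ : ℕ → ℕ → ℤ
δ m n = if m ℕ.≡ᵇ n then 1ℤ else 0ℤ

oneS : Series
oneS n = δ n 0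

qpow : ℕ → Series
qpow k n = δ n k

scale : ℤ → Series → Series
scale c f n = c ℤ.* f n

_⊕_ : Series → Series → Series
(f ⊕ g) n = f n ℤ.+ g n

_⊛_ : Series → Series → Series
(f ⊛ g) n = sumTo n (λ i → f i ℤ.* g (n ∸ i))

infixl 7 _⊛_
infixl 6 _⊕_

_^ˢ_ : Series → ℕ → Series
f ^ˢ zero  = oneS
f ^ˢ suc e = f ⊛ (f ^ˢ e)

prodS : List Series → Series
prodS = foldr _⊛_ oneS

oneMinus : ℤ → ℕ → Series
oneMinus a k n = δ n 0 - a ℤ.* δ n k

-- the series 1/(1 - a q^k) = Σ_j a^j q^{kj}, only meaningful for k ≥ 1
-- (value for k = 0 is an unused dummy)
geomInv : ℤ → ℕ → Series
geomInv a zero    = oneS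
geomInv a (suc k) n = if (n % suc k) ℕ.≡ᵇ 0 then a ℤ.^ (n / suc k) else 0ℤ

qPoch : ℤ → ℕ → ℕ → ℕ → Series
qPoch a b d n = prodS (map (λ i → oneMinus a (b ℕ.+ d ℕ.* i)) (upTo n))

-- 1 / (a q^b ; q^d)_n   (used only with b ≥ 1)
qPochInv : ℤ → ℕ → ℕ → ℕ → Series
qPochInv a b d n = prodS (map (λ i → geomInv a (b ℕ.+ d ℕ.* i)) (upTo n))

-- (q^k ; q^k)_∞ and its inverse, k ≥ 1: the coefficient of q^m only
-- depends on the factors (1 - q^{kj}) with j ≤ m (formal limit).
E : ℕ → Series
E k m = qPoch 1ℤ k k m m

Einv : ℕ → Series
Einv k m = qPochInv 1ℤ k k m m

-- Σ_{n ≥ 0} F n, for families where F n = O(q^n) (formal limit)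
sumS : (ℕ → Series) → Series
sumS F m = sumTo m (λ n → F n m)

sign : ℕ → ℤ
sign n = -1ℤ ℤ.^ n

-- Hauptmoduln.  j_N = q^{-1} ∏ (q^k;q^k)_∞^{e_k}; c_N n is the coefficient
-- of q^n in j_N, i.e. the coefficient of q^{n+1} in the product.

c₃ : ℕ → ℤ
c₃ n = (E 1 ^ˢ 12 ⊛ Einv 3 ^ˢ 12) (suc n)

c₆ : ℕ → ℤ
c₆ n = (E 2 ^ˢ 3 ⊛ E 3 ^ˢ 9 ⊛ Einv 1 ^ˢ 3 ⊛ Einv 6 ^ˢ 9) (suc n)

c₁₂ : ℕ → ℤ
c₁₂ n = (E 4 ^ˢ 4 ⊛ E 6 ^ˢ 2 ⊛ Einv 2 ^ˢ 2 ⊛ Einv 12 ^ˢ 4) (suc n)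

f₃ : Series
f₃ = sumS (λ n → qpow (n ℕ.* n) ⊛ (qPochInv -1ℤ 1 1 n) ^ˢ 2)

φ₃ : Series
φ₃ = sumS (λ n → qpow (n ℕ.* n) ⊛ qPochInv -1ℤ 2 2 n)

φ₆ : Series
φ₆ = sumS (λ n → scale (sign n) (qPoch 1ℤ 1 2 n ⊛ qpow (n ℕ.* n) ⊛ qPochInv -1ℤ 1 1 (2 ℕ.* n)))

ψ₆ : Series
ψ₆ = sumS (λ n → scale (sign n) (qpow (suc n ℕ.* suc n) ⊛ qPoch 1ℤ 1 2 n ⊛ qPochInv -1ℤ 1 1 (suc (2 ℕ.* n))))

λ₆ : Series
λ₆ = sumS (λ n → scale (sign n) (qpow n ⊛ qPoch 1ℤ 1 2 n ⊛ qPochInv -1ℤ 1 1 n))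

twoμ₆ : Series
twoμ₆ = oneS ⊕ sumS (λ n → scale (sign n)
          (qpow (suc n) ⊛ oneMinus -1ℤ n ⊛ qPoch 1ℤ 1 2 n ⊛ qPochInv -1ℤ 1 1 (suc n)))

-- Partitions: number of partitions of n into parts ≤ k, counted by
-- choosing the multiplicity j of the largest allowed part size.

partsLe : ℕ → ℕ → ℕ
partsLe n zero    = if n ℕ.≡ᵇ 0 then 1 else 0
partsLe n (suc k) = sum
  (map (λ j → if (j ℕ.* suc k) ≤ᵇ n then partsLe (n ∸ j ℕ.* suc k) k else 0) (upTo (suc n)))

p : ℕ → ℕ
p n = partsLe n n

_≡₂_ : ℤ → ℤ → Set
a ≡₂ b = (+ 2) ∣ (a - b)

infix 4 _≡₂_

{-# OPTIONS --safe #-}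

-- Everything takes place in 𝔽₂[[q]], where squaring is the substitution q ↦ q² and
-- (-q;q)ₙ = (q;q)ₙ.  Write e = (q;q)∞, r = 1/e, e₃ = e(q³), e₉ = e(q⁹), and let ψ = Σ q^(k(k+1)/2).
--
-- Gauss' identity (in the finite form Σ q^(s(s+1)/2) / ((q)ₙ₋ₛ(q)ₙ₊ₛ₊₁) = 1/(q;q²)ₙ₊₁) gives e³ = ψ.
-- Splitting the triangular numbers modulo 3 and using Euler's pentagonal number theorem,
-- e³ = e₃ + q e₉³.  Hence D = e³e₃³ + e¹² + q e₃¹² satisfies D(q) = q D(q³), so D = 0.
--
-- Now q j₃ = q j₁₂ = A⁴ and q j₆ = A⁴ + q with A = e³/e₃³, and the two identities dissect
-- A = r(q³)² + q B(q³) with B = e₃³ r³, and B = (e³)² + q C² with C = e₃⁶ r³.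
-- What is left is to recognise r, r², B and q C as the mock theta functions: f₃, φ₃ and φ₆ become
-- Σ q^(n²)/(q)ₙ² = r (Durfee squares), 2μ₆ telescopes to r², and λ₆ and ψ₆ are iterated along
-- z ↦ q²z to r² N and q r N², where N = Σ q^(n(n+1)) / (q;q²)ₙ₊₁ equals r e₃³ by Gauss' identity
-- and Durfee rectangles.
module Submission where

open import Defs
open import Data.Nat using (ℕ; zero; suc; _+_; _*_; _∸_; _≤_; _<_; _/_; _%_; _≡ᵇ_; _≤ᵇ_; z≤n; s≤s; s≤s⁻¹; parity; NonZero; >-nonZero⁻¹)
open import Data.Nat.Properties
open import Data.Nat.DivMod
import Data.Nat.Divisibility as ℕ
open import Data.Nat.ListAction using (sum)
open import Data.Nat.Tactic.RingSolver using (solve-∀)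
open import Data.Integer as ℤ using (ℤ; +_; -[1+_]; ∣_∣; _⊖_; 0ℤ; 1ℤ; -1ℤ)
import Data.Integer.Properties as ℤ
open import Data.Parity.Base as ℙ using (Parity; 0ℙ; 1ℙ)
import Data.Parity.Properties as ℙ
open import Data.Bool as Bool using (if_then_else_)
import Data.Bool.Properties as Bool
open import Data.List using (map; applyUpTo; upTo)
open import Data.Maybe.Base using (just; nothing)
open import Data.Product using (_×_; _,_; ∃)
open import Data.Sum using (inj₁; inj₂)
open import Function using (id; _∘_)
open import Function.Bundles using (_⇔_; mk⇔)
open import Level using (0ℓ)
open import Relation.Nullary using (yes; no; contradiction)
open import Relation.Nullary.Reflects using (ofʸ; ofⁿ)
open import Relation.Binary.Bundles using (Setoid)
open import Relation.Binary.Definitions using (WeaklyDecidable)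
open import Relation.Binary.PropositionalEquality as ≡ using (_≡_; _≢_; cong; cong₂)
import Relation.Binary.Reasoning.Setoid
open import Algebra.Bundles using (CommutativeRing)
open import Algebra.Structures using (IsCommutativeRing)
open import Algebra.Solver.Ring.AlmostCommutativeRing using (fromCommutativeRing; _-Raw-AlmostCommutative⟶_)
import Algebra.Solver.Ring
import Algebra.Properties.CommutativeSemigroup
import Algebra.Properties.Semiring.Exp

-- No limits are taken. The n-th coefficient of an infinite sum or product is read off its first n +
-- 1 terms or factors, and an identity between infinite objects is reached through finite identities
-- whose remainder is divisible by q^N, for every N. This is why the partial sums carry explicit
-- boundary terms, and why the free variable z of the classical arguments occurs only as an odd
-- power of q, indexed by a natural number m.
--
-- The modulus 24 is 4 · 3 · 2. Passing from A⁴ = A(q⁴) to `A` divides the index by 4, the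
-- dissection of `A` sorts it modulo 3, and what is left, r² or `B`, is a square or a square plus q
-- times a square, so that the parity of the index decides. The classes of even coefficients are
-- those that miss these supports.
--
-- The series `𝒩` serves two functions: the iteration for λ₆ produces its terms, the one for ψ₆ the
-- squares of its terms, and modulo 2 a sum of squares is the square of the sum.

private module ℙ+ = Algebra.Properties.CommutativeSemigroup (CommutativeRing.+-commutativeSemigroup ℙ.+-*-commutativeRing)

-- Power series over 𝔽₂

Ser : Set
Ser = ℕ → Parity

infix 4 _≈_ _≈[_]_

-- A record rather than a bare pointwise equation, so that both series can be recovered from a
-- proof.
record _≈_ (f g : Ser) : Set where
  constructor mk≈
  field at : ∀ n → f n ≡ g n
open _≈_

-- Congruence modulo q^N, the substitute for convergence.
record _≈[_]_ (f : Ser) (N : ℕ) (g : Ser) : Set where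
  constructor mk≈[]
  field below : ∀ n → n < N → f n ≡ g n
open _≈[_]_

tail : Ser → Ser
tail f n = f (suc n)

shift : Ser → Ser
shift f zero    = 0ℙ
shift f (suc n) = f n

const : Parity → Ser
const c zero    = c
const c (suc _) = 0ℙ

𝟘 𝟙 ones : Ser
𝟘 _ = 0ℙ
𝟙 = const 1ℙ
ones _ = 1ℙ

infixl 6 _∔_
infixl 7 _·_
infix  9 X^_

opaque
  _∔_ : Ser → Ser → Ser
  (f ∔ g) n = f n ℙ.+ g n

  -- The Cauchy product, unrolled as f g = f(0) g + q (tail f) g. The ring laws then follow by
  -- induction on the coefficient index, with the series left general.
  _·_ : Ser → Ser → Ser
  (f · g) zero    = f 0 ℙ.* g 0
  (f · g) (suc n) = f 0 ℙ.* g (suc n) ℙ.+ (tail f · g) n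

  ∔-at : ∀ f g n → (f ∔ g) n ≡ f n ℙ.+ g n
  ∔-at f g n = ≡.refl

  ·-at-zero : ∀ f g → (f · g) 0 ≡ f 0 ℙ.* g 0
  ·-at-zero f g = ≡.refl

  ·-at-suc : ∀ f g n → (f · g) (suc n) ≡ f 0 ℙ.* g (suc n) ℙ.+ (tail f · g) n
  ·-at-suc f g n = ≡.refl

opaque
  X^_ : ℕ → Ser
  X^ zero  = 𝟙
  X^ suc k = shift (X^ k)

opaque
  unfolding _∔_

  ·-below : ∀ n {f f' g g'} → (∀ i → i ≤ n → f i ≡ f' i) → (∀ i → i ≤ n → g i ≡ g' i) →
            (f · g) n ≡ (f' · g') n
  ·-below zero    p q = cong₂ ℙ._*_ (p 0 z≤n) (q 0 z≤n)
  ·-below (suc n) p q = cong₂ ℙ._+_ (cong₂ ℙ._*_ (p 0 z≤n) (q (suc n) ≤-refl))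
    (·-below n (λ i i≤n → p (suc i) (s≤s i≤n)) (λ i i≤n → q i (m≤n⇒m≤1+n i≤n)))

  -- The recursion of `_·_` peels the left factor; peeling the right one as well is what turns
  -- commutativity into an induction.
  ·-at-suc′ : ∀ n f g → (f · g) (suc n) ≡ f (suc n) ℙ.* g 0 ℙ.+ (f · tail g) n
  ·-at-suc′ zero    f g = ℙ.+-comm (f 0 ℙ.* g 1) (f 1 ℙ.* g 0)
  ·-at-suc′ (suc n) f g rewrite ·-at-suc′ n (tail f) g =
    ℙ+.x∙yz≈y∙xz (f 0 ℙ.* g (2 + n)) (f (2 + n) ℙ.* g 0) ((tail f · tail g) n)

  ·-comm-at : ∀ n f g → (f · g) n ≡ (g · f) n
  ·-comm-at zero    f g = ℙ.*-comm (f 0) (g 0)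
  ·-comm-at (suc n) f g = ≡.trans (·-at-suc′ n f g)
    (cong₂ ℙ._+_ (ℙ.*-comm (f (suc n)) (g 0)) (·-comm-at n f (tail g)))

  ·-distribʳ-at : ∀ n f g h → ((g ∔ h) · f) n ≡ (g · f) n ℙ.+ (h · f) n
  ·-distribʳ-at zero    f g h = ℙ.*-distribʳ-+ (f 0) (g 0) (h 0)
  ·-distribʳ-at (suc n) f g h = ≡.trans
    (cong₂ ℙ._+_ (ℙ.*-distribʳ-+ (f (suc n)) (g 0) (h 0)) (·-distribʳ-at n f (tail g) (tail h)))
    (ℙ+.interchange (g 0 ℙ.* f (suc n)) _ _ _)

  ·-scalar-at : ∀ n c g h → ((λ i → c ℙ.* g i) · h) n ≡ c ℙ.* (g · h) n
  ·-scalar-at zero    c g h = ℙ.*-assoc c (g 0) (h 0)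
  ·-scalar-at (suc n) c g h = ≡.trans
    (cong₂ ℙ._+_ (ℙ.*-assoc c (g 0) (h (suc n))) (·-scalar-at n c (tail g) h))
    (≡.sym (ℙ.*-distribˡ-+ c _ _))

  ·-assoc-at : ∀ n f g h → ((f · g) · h) n ≡ (f · (g · h)) n
  ·-assoc-at zero    f g h = ℙ.*-assoc (f 0) (g 0) (h 0)
  ·-assoc-at (suc n) f g h = begin
    (f 0 ℙ.* g 0) ℙ.* h (suc n) ℙ.+ (tail (f · g) · h) n
      ≡⟨ cong₂ ℙ._+_ (ℙ.*-assoc (f 0) (g 0) (h (suc n))) (·-distribʳ-at n h (λ i → f 0 ℙ.* g (suc i)) (tail f · g)) ⟩
    f 0 ℙ.* (g 0 ℙ.* h (suc n)) ℙ.+ (((λ i → f 0 ℙ.* g (suc i)) · h) n ℙ.+ ((tail f · g) · h) n)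
      ≡⟨ cong₂ (λ a b → f 0 ℙ.* (g 0 ℙ.* h (suc n)) ℙ.+ (a ℙ.+ b)) (·-scalar-at n (f 0) (tail g) h) (·-assoc-at n (tail f) g h) ⟩
    f 0 ℙ.* (g 0 ℙ.* h (suc n)) ℙ.+ ((f 0 ℙ.* (tail g · h) n) ℙ.+ (tail f · (g · h)) n)
      ≡⟨ ℙ.+-assoc (f 0 ℙ.* (g 0 ℙ.* h (suc n))) _ _ ⟨
    (f 0 ℙ.* (g 0 ℙ.* h (suc n)) ℙ.+ (f 0 ℙ.* (tail g · h) n)) ℙ.+ (tail f · (g · h)) n
      ≡⟨ cong (ℙ._+ (tail f · (g · h)) n) (ℙ.*-distribˡ-+ (f 0) _ _) ⟨
    f 0 ℙ.* (g · h) (suc n) ℙ.+ (tail f · (g · h)) n ∎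
    where open ≡.≡-Reasoning

  𝟘·-at : ∀ n f → (𝟘 · f) n ≡ 0ℙ
  𝟘·-at zero    f = ≡.refl
  𝟘·-at (suc n) f = 𝟘·-at n f

  const·-at : ∀ n c f → (const c · f) n ≡ c ℙ.* f n
  const·-at zero    c f = ≡.refl
  const·-at (suc n) c f = ≡.trans (cong (c ℙ.* f (suc n) ℙ.+_) (𝟘·-at n f)) (ℙ.+-identityʳ _)

  shift·-at : ∀ n f g → (shift f · g) n ≡ shift (f · g) n
  shift·-at zero    f g = ≡.refl
  shift·-at (suc n) f g = ≡.refl

  -- `id` is the negation: in characteristic 2 every series is its own additive inverse.
  ring-laws : IsCommutativeRing _≈_ _∔_ _·_ id 𝟘 𝟙
  ring-laws = record
    { isRing = record
      { +-isAbelianGroup = record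
        { isGroup = record
          { isMonoid = record
            { isSemigroup = record
              { isMagma = record
                { isEquivalence = record
                  { refl = mk≈ λ _ → ≡.refl
                  ; sym = λ p → mk≈ λ n → ≡.sym (at p n)
                  ; trans = λ p q → mk≈ λ n → ≡.trans (at p n) (at q n) }
                ; ∙-cong = λ p q → mk≈ λ n → cong₂ ℙ._+_ (at p n) (at q n) }
              ; assoc = λ f g h → mk≈ λ n → ℙ.+-assoc (f n) (g n) (h n) }
            ; identity = (λ f → mk≈ λ n → ≡.refl) , (λ f → mk≈ λ n → ℙ.+-identityʳ (f n)) }
          ; inverse = (λ f → mk≈ λ n → ℙ.p+p≡0ℙ (f n)) , (λ f → mk≈ λ n → ℙ.p+p≡0ℙ (f n))
          ; ⁻¹-cong = λ p → p }
        ; comm = λ f g → mk≈ λ n → ℙ.+-comm (f n) (g n) }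
      ; *-cong = λ p q → mk≈ λ n → ·-below n (λ i _ → at p i) (λ i _ → at q i)
      ; *-assoc = λ f g h → mk≈ λ n → ·-assoc-at n f g h
      ; *-identity = (λ f → mk≈ λ n → const·-at n 1ℙ f)
                   , (λ f → mk≈ λ n → ≡.trans (·-comm-at n f 𝟙) (const·-at n 1ℙ f))
      ; distrib = (λ f g h → mk≈ λ n → ≡.trans (·-comm-at n f (g ∔ h)) (≡.trans (·-distribʳ-at n f g h)
                    (cong₂ ℙ._+_ (·-comm-at n g f) (·-comm-at n h f))))
                , (λ f g h → mk≈ λ n → ·-distribʳ-at n f g h) }
    ; *-comm = λ f g → mk≈ λ n → ·-comm-at n f g }

  const-∔ : ∀ a b → const (a ℙ.+ b) ≈ const a ∔ const b
  const-∔ a b = mk≈ λ { zero → ≡.refl ; (suc n) → ≡.refl }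

  const-· : ∀ a b → const (a ℙ.* b) ≈ const a · const b
  const-· a b = mk≈ λ
    { zero    → ≡.refl
    ; (suc n) → ≡.sym (≡.trans (const·-at (suc n) a (const b)) (ℙ.*-zeroʳ a)) }

  ∔-cong[] : ∀ {N f f' g g'} → f ≈[ N ] f' → g ≈[ N ] g' → f ∔ g ≈[ N ] f' ∔ g'
  ∔-cong[] p q = mk≈[] λ n n<N → cong₂ ℙ._+_ (below p n n<N) (below q n n<N)

  ·-cong[] : ∀ {N f f' g g'} → f ≈[ N ] f' → g ≈[ N ] g' → f · g ≈[ N ] f' · g'
  ·-cong[] p q = mk≈[] λ n n<N →
    ·-below n (λ i i≤n → below p i (≤-<-trans i≤n n<N)) (λ i i≤n → below q i (≤-<-trans i≤n n<N))

𝔽₂[[q]] : CommutativeRing 0ℓ 0ℓ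
𝔽₂[[q]] = record { isCommutativeRing = ring-laws }

open CommutativeRing 𝔽₂[[q]]
  using (setoid; refl; sym; trans; reflexive; semiring)
  renaming ( +-cong to ∔-cong; +-congˡ to ∔-congˡ; +-congʳ to ∔-congʳ; +-identityʳ to ∔-identityʳ; +-identityˡ to ∔-identityˡ
           ; *-cong to ·-cong; *-congˡ to ·-congˡ; *-congʳ to ·-congʳ; *-identityʳ to ·-identityʳ; *-identityˡ to ·-identityˡ
           ; *-assoc to ·-assoc; *-comm to ·-comm; zeroʳ to ·-zeroʳ; zeroˡ to ·-zeroˡ; -‿inverseʳ to f∔f≈𝟘
           ; distribˡ to ·-distribˡ-∔; +-comm to ∔-comm; +-assoc to ∔-assoc)
open Algebra.Properties.Semiring.Exp semiring
  using () renaming (_^_ to _↑_; ^-congˡ to ↑-congˡ)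

module ≈-Reasoning = Relation.Binary.Reasoning.Setoid setoid

const≟ : WeaklyDecidable (λ a b → const a ≈ const b)
const≟ a b with a ℙ.≟ b
... | yes a≡b = just (reflexive (cong const a≡b))
... | no  _   = nothing

const-homomorphism : CommutativeRing.rawRing ℙ.+-*-commutativeRing -Raw-AlmostCommutative⟶ fromCommutativeRing 𝔽₂[[q]]
const-homomorphism = record
  { ⟦_⟧ = const ; +-homo = const-∔ ; *-homo = const-· ; -‿homo = λ _ → refl
  ; 0-homo = mk≈ (λ { zero → ≡.refl ; (suc _) → ≡.refl }) ; 1-homo = refl }

-- With the coefficients taken in 𝔽₂ the solver knows that f ∔ f ≈ 𝟘.
module Solver = Algebra.Solver.Ring
  (CommutativeRing.rawRing ℙ.+-*-commutativeRing) (fromCommutativeRing 𝔽₂[[q]]) const-homomorphism const≟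

open Solver using (solve; con; _:+_; _:*_; _:^_; _:=_)

-- Congruence modulo a power of q

setoid[_] : ℕ → Setoid 0ℓ 0ℓ
setoid[ N ] = record
  { Carrier = Ser ; _≈_ = λ f g → f ≈[ N ] g
  ; isEquivalence = record
    { refl  = mk≈[] λ _ _ → ≡.refl
    ; sym   = λ p → mk≈[] λ n n<N → ≡.sym (below p n n<N)
    ; trans = λ p q → mk≈[] λ n n<N → ≡.trans (below p n n<N) (below q n n<N) } }

module ≈[]-Reasoning (N : ℕ) = Relation.Binary.Reasoning.Setoid setoid[ N ]

refl[] : ∀ {N f} → f ≈[ N ] f
refl[] {N} = Setoid.refl setoid[ N ]

sym[] : ∀ {N f g} → f ≈[ N ] g → g ≈[ N ] f
sym[] {N} = Setoid.sym setoid[ N ]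

trans[] : ∀ {N f g h} → f ≈[ N ] g → g ≈[ N ] h → f ≈[ N ] h
trans[] {N} = Setoid.trans setoid[ N ]

≈⇒≈[] : ∀ {N f g} → f ≈ g → f ≈[ N ] g
≈⇒≈[] p = mk≈[] λ n _ → at p n

≈[]⇒≈ : ∀ {f g} → (∀ N → f ≈[ N ] g) → f ≈ g
≈[]⇒≈ p = mk≈ λ n → below (p (suc n)) n ≤-refl

weaken : ∀ {M N f g} → M ≤ N → f ≈[ N ] g → f ≈[ M ] g
weaken M≤N p = mk≈[] λ n n<M → below p n (<-≤-trans n<M M≤N)

-- In characteristic 2 a sum is a difference, so an equation can be proved in the vanishing form
-- that `X-descent` delivers.
∔≈𝟘⇒≈ : ∀ {f g} → f ∔ g ≈ 𝟘 → f ≈ g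
∔≈𝟘⇒≈ {f} {g} p = begin
  f             ≈⟨ solve 2 (λ x y → x := (x :+ y) :+ y) refl f g ⟩
  (f ∔ g) ∔ g   ≈⟨ ∔-congʳ p ⟩
  𝟘 ∔ g         ≈⟨ ∔-identityˡ g ⟩
  g             ∎
  where open ≈-Reasoning

opaque
  unfolding X^_

  X^-zero : X^ 0 ≈ 𝟙
  X^-zero = refl

  X^-suc-at-zero : ∀ k → (X^ suc k) 0 ≡ 0ℙ
  X^-suc-at-zero k = ≡.refl

  tail-X^-suc : ∀ k → tail (X^ suc k) ≈ X^ k
  tail-X^-suc k = refl

  X^-+ : ∀ m n → X^ (m + n) ≈ X^ m · X^ n
  X^-+ zero    n = sym (·-identityˡ (X^ n))
  X^-+ (suc m) n = mk≈ λ
    { zero    → ≡.sym (shift·-at 0 (X^ m) (X^ n))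
    ; (suc i) → ≡.trans (at (X^-+ m n) i) (≡.sym (shift·-at (suc i) (X^ m) (X^ n))) }

  X^·-at-< : ∀ k f n → n < k → (X^ k · f) n ≡ 0ℙ
  X^·-at-< (suc k) f zero    _ = shift·-at 0 (X^ k) f
  X^·-at-< (suc k) f (suc n) n<k = ≡.trans (shift·-at (suc n) (X^ k) f) (X^·-at-< k f n (s≤s⁻¹ n<k))

  X^·-at-+ : ∀ k f n → (X^ k · f) (k + n) ≡ f n
  X^·-at-+ zero    f n = at (·-identityˡ f) n
  X^·-at-+ (suc k) f n = ≡.trans (shift·-at (suc (k + n)) (X^ k) f) (X^·-at-+ k f n)

X^-cong : ∀ {m n} → m ≡ n → X^ m ≈ X^ n
X^-cong p = reflexive (cong X^_ p)

X^·≈𝟘 : ∀ {k N} f → N ≤ k → X^ k · f ≈[ N ] 𝟘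
X^·≈𝟘 {k} f N≤k = mk≈[] λ n n<N → X^·-at-< k f n (<-≤-trans n<N N≤k)

X^·-cong[] : ∀ k {N f g} → f ≈[ N ] g → X^ k · f ≈[ k + N ] X^ k · g
X^·-cong[] k {N} {f} {g} p = mk≈[] h
  where
  h : ∀ n → n < k + N → (X^ k · f) n ≡ (X^ k · g) n
  h n n<k+N with <-≤-connex n k
  ... | inj₁ n<k = ≡.trans (X^·-at-< k f n n<k) (≡.sym (X^·-at-< k g n n<k))
  ... | inj₂ k≤n with m , ≡.refl ← m≤n⇒∃[o]m+o≡n k≤n =
    ≡.trans (X^·-at-+ k f m) (≡.trans (below p m (+-cancelˡ-< k m N n<k+N)) (≡.sym (X^·-at-+ k g m)))

-- Each use of the relation gains at least one factor q, so N uses show that `Δ i` vanishes modulo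
-- q^N. A whole family descends at once because the index changes on the way; in the applications it
-- is a series and `next` is `tail`.
X-descent : ∀ {I : Set} (Δ : I → Ser) (next : I → I) (k : I → ℕ) →
            (∀ i → Δ i ≈ X^ suc (k i) · Δ (next i)) → ∀ i → Δ i ≈ 𝟘
X-descent {I} Δ next k step i = ≈[]⇒≈ (λ N → vanish N i)
  where
  vanish : ∀ N i → Δ i ≈[ N ] 𝟘
  vanish zero    i = mk≈[] λ _ ()
  vanish (suc N) i = begin
    Δ i                          ≈⟨ ≈⇒≈[] (step i) ⟩
    X^ suc (k i) · Δ (next i)    ≈⟨ weaken (s≤s (m≤n+m N (k i))) (X^·-cong[] (suc (k i)) (vanish N (next i))) ⟩
    X^ suc (k i) · 𝟘             ≈⟨ ≈⇒≈[] (·-zeroʳ (X^ suc (k i))) ⟩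
    𝟘                            ∎
    where open ≈[]-Reasoning (suc N)

-- Substitution of a power of q

-- dil k f is f(qᵏ), and geo k below is 1 / (1 - qᵏ).
dil : (k : ℕ) .{{_ : NonZero k}} → Ser → Ser
dil k f n = if n % k ≡ᵇ 0 then f (n / k) else 0ℙ

geo : (k : ℕ) .{{_ : NonZero k}} → Ser
geo k = dil k ones

module _ (k : ℕ) .{{_ : NonZero k}} where

  dil-at : ∀ f {n a b} → n % k ≡ a → n / k ≡ b → dil k f n ≡ (if a ≡ᵇ 0 then f b else 0ℙ)
  dil-at f p q = cong₂ (λ a b → if a ≡ᵇ 0 then f b else 0ℙ) p q

  dil-at-+ : ∀ f n → dil k f (k + n) ≡ dil k (tail f) n
  dil-at-+ f n = dil-at f
    (≡.trans (cong (_% k) (+-comm k n)) ([m+n]%n≡m%n n k))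
    (≡.trans (+-distrib-/-∣ˡ n {k} ℕ.∣-refl) (cong (_+ n / k) (n/n≡1 k)))

  dil-at-< : ∀ f n → suc n < k → dil k f (suc n) ≡ 0ℙ
  dil-at-< f n n<k = dil-at f {suc n} (m<n⇒m%n≡m n<k) ≡.refl

  dil-at-* : ∀ f n → dil k f (n * k) ≡ f n
  dil-at-* f n = dil-at f (m*n%n≡0 n k) (m*n/n≡m n k)

  dil-at-off : ∀ f n j → suc j < k → dil k f (suc j + n * k) ≡ 0ℙ
  dil-at-off f n j j<k = dil-at f (≡.trans ([m+kn]%n≡m%n (suc j) n k) (m<n⇒m%n≡m j<k)) ≡.refl

  dil-cong[] : ∀ {N f g} → f ≈[ N ] g → dil k f ≈[ N ] dil k g
  dil-cong[] {N} {f} {g} p = mk≈[] λ n n<N →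
    cong (if n % k ≡ᵇ 0 then_else 0ℙ) (below p (n / k) (≤-<-trans (m/n≤m n k) n<N))

  dil-cong : ∀ {f g} → f ≈ g → dil k f ≈ dil k g
  dil-cong p = ≈[]⇒≈ (λ N → dil-cong[] {N} (≈⇒≈[] p))

  dil-∔ : ∀ f g → dil k (f ∔ g) ≈ dil k f ∔ dil k g
  dil-∔ f g = mk≈ λ n → ≡.trans (h n) (≡.sym (∔-at (dil k f) (dil k g) n))
    where
    h : ∀ n → dil k (f ∔ g) n ≡ dil k f n ℙ.+ dil k g n
    h n with n % k ≡ᵇ 0
    ... | Bool.true  = ∔-at f g (n / k)
    ... | Bool.false = ≡.refl

  dil-const· : ∀ c f → dil k (const c · f) ≈ const c · dil k f
  dil-const· c f = mk≈ λ n → ≡.trans (h n) (≡.sym (const·-at n c (dil k f)))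
    where
    h : ∀ n → dil k (const c · f) n ≡ c ℙ.* dil k f n
    h n with n % k ≡ᵇ 0
    ... | Bool.true  = const·-at (n / k) c f
    ... | Bool.false = ≡.sym (ℙ.*-zeroʳ c)

  -- Horner's rule f = f(0) + q (tail f), taken at q^k. It turns the laws of `dil` that involve
  -- products or composition into descents along `tail`.
  dil-horner : ∀ f → dil k f ≈ const (f 0) ∔ X^ k · dil k (tail f)
  dil-horner f = mk≈ λ n → ≡.trans (h n) (≡.sym (∔-at (const (f 0)) (X^ k · dil k (tail f)) n))
    where
    const-+ : ∀ k m → 0 < k → const (f 0) (k + m) ≡ 0ℙ
    const-+ (suc k) m _ = ≡.refl
    h : ∀ n → dil k f n ≡ const (f 0) n ℙ.+ (X^ k · dil k (tail f)) n
    h n with <-≤-connex n k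
    h zero    | inj₁ n<k rewrite X^·-at-< k (dil k (tail f)) 0 n<k | ℙ.+-identityʳ (f 0) = dil-at-* f 0
    h (suc n) | inj₁ n<k rewrite X^·-at-< k (dil k (tail f)) (suc n) n<k = dil-at-< f n n<k
    h n       | inj₂ k≤n with m , ≡.refl ← m≤n⇒∃[o]m+o≡n k≤n
      rewrite X^·-at-+ k (dil k (tail f)) m | const-+ k m (>-nonZero⁻¹ k) = dil-at-+ f m

horner : ∀ f → f ≈ const (f 0) ∔ X^ 1 · tail f
horner f = mk≈ λ n → ≡.trans (h n) (≡.sym (∔-at (const (f 0)) (X^ 1 · tail f) n))
  where
  h : ∀ n → f n ≡ const (f 0) n ℙ.+ (X^ 1 · tail f) n
  h zero    rewrite X^·-at-< 1 (tail f) 0 (s≤s z≤n) = ≡.sym (ℙ.+-identityʳ (f 0))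
  h (suc n) = ≡.sym (X^·-at-+ 1 (tail f) n)

tail-· : ∀ f g → tail (f · g) ≈ const (f 0) · tail g ∔ tail f · g
tail-· f g = mk≈ λ n → ≡.trans (·-at-suc f g n) (≡.sym (≡.trans (∔-at (const (f 0) · tail g) (tail f · g) n)
  (cong (ℙ._+ (tail f · g) n) (const·-at n (f 0) (tail g)))))

module _ (k-1 : ℕ) where
  private k = suc k-1

  -- Both sides obey the same Horner recursion in `f` with `g` fixed, so their difference at `f` is
  -- q^k times their difference at `tail f`.
  dil-· : ∀ f g → dil k (f · g) ≈ dil k f · dil k g
  dil-· f g = ∔≈𝟘⇒≈ (X-descent (λ f → dil k (f · g) ∔ dil k f · dil k g) tail (λ _ → k-1) step f)
    where
    open ≈-Reasoning
    step : ∀ f → dil k (f · g) ∔ dil k f · dil k g ≈ X^ k · (dil k (tail f · g) ∔ dil k (tail f) · dil k g)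
    step f = begin
      dil k (f · g) ∔ dil k f · dil k g
        ≈⟨ ∔-cong (trans (dil-horner k (f · g)) (∔-cong (trans (reflexive (cong const (·-at-zero f g))) (const-· (f 0) (g 0)))
             (·-congˡ (trans (dil-cong k (tail-· f g)) (trans (dil-∔ k (const (f 0) · tail g) (tail f · g)) (∔-congʳ (dil-const· k (f 0) (tail g))))))))
             (·-congʳ (dil-horner k f)) ⟩
      (a · b ∔ x · (a · dtg ∔ d)) ∔ (a ∔ x · dtf) · dil k g
        ≈⟨ solve 7 (λ a b x dtg d dtf dg → ((a :* b) :+ x :* (a :* dtg :+ d)) :+ (a :+ x :* dtf) :* dg
                     := a :* ((b :+ x :* dtg) :+ dg) :+ x :* (d :+ dtf :* dg)) refl a b x dtg d dtf (dil k g) ⟩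
      a · ((b ∔ x · dtg) ∔ dil k g) ∔ x · (d ∔ dtf · dil k g)
        ≈⟨ ∔-congʳ (trans (·-congˡ (trans (∔-congʳ (sym (dil-horner k g))) (f∔f≈𝟘 (dil k g)))) (·-zeroʳ a)) ⟩
      𝟘 ∔ x · (d ∔ dtf · dil k g)
        ≈⟨ ∔-identityˡ _ ⟩
      x · (d ∔ dtf · dil k g) ∎
      where
      a b x dtg d dtf : Ser
      a = const (f 0) ; b = const (g 0) ; x = X^ k
      dtg = dil k (tail g) ; d = dil k (tail f · g) ; dtf = dil k (tail f)

  dil-𝟙 : dil k 𝟙 ≈ 𝟙
  dil-𝟙 = trans (dil-horner k 𝟙) (trans (∔-congˡ (trans (·-congˡ (mk≈ dil-𝟘)) (·-zeroʳ (X^ k)))) (∔-identityʳ 𝟙))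
    where
    dil-𝟘 : ∀ n → dil k (tail 𝟙) n ≡ 0ℙ
    dil-𝟘 n with n % k ≡ᵇ 0
    ... | Bool.true  = ≡.refl
    ... | Bool.false = ≡.refl

  dil-X^ : ∀ n → dil k (X^ n) ≈ X^ (n * k)
  dil-X^ zero    = trans (dil-cong k X^-zero) (trans dil-𝟙 (sym X^-zero))
  dil-X^ (suc n) = begin
    dil k (X^ suc n)
      ≈⟨ dil-horner k (X^ suc n) ⟩
    const ((X^ suc n) 0) ∔ X^ k · dil k (tail (X^ suc n))
      ≈⟨ ∔-cong (trans (reflexive (cong const (X^-suc-at-zero n))) (mk≈ λ { zero → ≡.refl ; (suc _) → ≡.refl }))
                (·-congˡ (trans (dil-cong k (tail-X^-suc n)) (dil-X^ n))) ⟩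
    𝟘 ∔ X^ k · X^ (n * k)       ≈⟨ ∔-identityˡ _ ⟩
    X^ k · X^ (n * k)           ≈⟨ X^-+ k (n * k) ⟨
    X^ (k + n * k)              ∎
    where open ≈-Reasoning

  dil-↑ : ∀ f n → dil k (f ↑ n) ≈ dil k f ↑ n
  dil-↑ f zero    = dil-𝟙
  dil-↑ f (suc n) = trans (dil-· f (f ↑ n)) (·-congˡ (dil-↑ f n))

  dil-const : ∀ c → dil k (const c) ≈ const c
  dil-const c = trans (dil-cong k (sym (·-identityʳ (const c)))) (trans (dil-const· k c 𝟙) (trans (·-congˡ dil-𝟙) (·-identityʳ _)))

  geo-inverse : (𝟙 ∔ X^ k) · geo k ≈ 𝟙
  geo-inverse = begin
    (𝟙 ∔ X^ k) · geo k               ≈⟨ solve 2 (λ x g → (con 1ℙ :+ x) :* g := g :+ x :* g) refl (X^ k) (geo k) ⟩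
    geo k ∔ X^ k · geo k             ≈⟨ ∔-congʳ (dil-horner k ones) ⟩
    (𝟙 ∔ X^ k · geo k) ∔ X^ k · geo k ≈⟨ solve 2 (λ a b → (a :+ b) :+ b := a) refl 𝟙 (X^ k · geo k) ⟩
    𝟙 ∎
    where open ≈-Reasoning

dil-dil : ∀ j k f → dil (suc j) (dil (suc k) f) ≈ dil (suc k * suc j) f
dil-dil j k f = ∔≈𝟘⇒≈ (X-descent (λ f → dil (suc j) (dil (suc k) f) ∔ dil (suc k * suc j) f) tail (λ _ → j + k * suc j) step f)
  where
  open ≈-Reasoning
  step : ∀ f → dil (suc j) (dil (suc k) f) ∔ dil (suc k * suc j) f
             ≈ X^ (suc k * suc j) · (dil (suc j) (dil (suc k) (tail f)) ∔ dil (suc k * suc j) (tail f))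
  step f = begin
    dil (suc j) (dil (suc k) f) ∔ dil (suc k * suc j) f
      ≈⟨ ∔-cong (trans (dil-cong (suc j) (dil-horner (suc k) f)) (trans (dil-∔ (suc j) (const (f 0)) (X^ suc k · dil (suc k) (tail f)))
           (∔-cong (dil-const j (f 0)) (trans (dil-· j (X^ suc k) (dil (suc k) (tail f))) (·-congʳ (dil-X^ j (suc k)))))))
         (dil-horner (suc k * suc j) f) ⟩
    (const (f 0) ∔ X^ (suc k * suc j) · u) ∔ (const (f 0) ∔ X^ (suc k * suc j) · v)
      ≈⟨ solve 4 (λ c x u v → (c :+ x :* u) :+ (c :+ x :* v) := x :* (u :+ v)) refl (const (f 0)) (X^ (suc k * suc j)) u v ⟩
    X^ (suc k * suc j) · (u ∔ v) ∎
    where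
    u v : Ser
    u = dil (suc j) (dil (suc k) (tail f)) ; v = dil (suc k * suc j) (tail f)

-- Squaring c + q t leaves no cross term, and c² = c in 𝔽₂; the defect at `f` is therefore q² times
-- the defect at `tail f`.
frobenius : ∀ f → f · f ≈ dil 2 f
frobenius f = ∔≈𝟘⇒≈ (X-descent (λ f → f · f ∔ dil 2 f) tail (λ _ → 1) step f)
  where
  open ≈-Reasoning
  step : ∀ f → f · f ∔ dil 2 f ≈ X^ 2 · (tail f · tail f ∔ dil 2 (tail f))
  step f = begin
    f · f ∔ dil 2 f
      ≈⟨ ∔-cong (·-cong (horner f) (horner f)) (dil-horner 2 f) ⟩
    (c ∔ X^ 1 · t) · (c ∔ X^ 1 · t) ∔ (c ∔ X^ 2 · dil 2 t)
      ≈⟨ solve 5 (λ c x t x² d → (c :+ x :* t) :* (c :+ x :* t) :+ (c :+ x² :* d)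
                  := (c :* c :+ c) :+ ((x :* x) :* (t :* t) :+ x² :* d)) refl c (X^ 1) t (X^ 2) (dil 2 t) ⟩
    (c · c ∔ c) ∔ ((X^ 1 · X^ 1) · (t · t) ∔ X^ 2 · dil 2 t)
      ≈⟨ ∔-cong (trans (∔-congʳ (trans (sym (const-· (f 0) (f 0))) (reflexive (cong const (ℙ.*-idem (f 0)))))) (f∔f≈𝟘 c))
                (∔-congʳ (·-congʳ (sym (X^-+ 1 1)))) ⟩
    𝟘 ∔ (X^ 2 · (t · t) ∔ X^ 2 · dil 2 t)
      ≈⟨ trans (∔-identityˡ _) (sym (·-distribˡ-∔ (X^ 2) (t · t) (dil 2 t))) ⟩
    X^ 2 · (t · t ∔ dil 2 t) ∎
    where
    c t : Ser
    c = const (f 0) ; t = tail f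

square-at-even : ∀ f n → (f · f) (n * 2) ≡ f n
square-at-even f n = ≡.trans (at (frobenius f) (n * 2)) (dil-at-* 2 f n)

square-at-odd : ∀ f n → (f · f) (suc (n * 2)) ≡ 0ℙ
square-at-odd f n = ≡.trans (at (frobenius f) (suc (n * 2))) (dil-at-off 2 f n 0 (s≤s (s≤s z≤n)))

-- Finite and infinite sums and products

∑ ∏ : ℕ → (ℕ → Ser) → Ser
∑ zero    F = 𝟘
∑ (suc n) F = ∑ n F ∔ F n
∏ zero    F = 𝟙
∏ (suc n) F = ∏ n F · F n

-- Meaningful when F n is congruent to 𝟘 (respectively 𝟙) modulo qⁿ.
∑∞ ∏∞ : (ℕ → Ser) → Ser
∑∞ F n = ∑ (suc n) F n
∏∞ F n = ∏ (suc n) F n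

∑-cong[] : ∀ {N F G} n → (∀ i → i < n → F i ≈[ N ] G i) → ∑ n F ≈[ N ] ∑ n G
∑-cong[] zero    p = refl[]
∑-cong[] (suc n) p = ∔-cong[] (∑-cong[] n (λ i i<n → p i (m<n⇒m<1+n i<n))) (p n ≤-refl)

∑-cong : ∀ {F G} n → (∀ i → i < n → F i ≈ G i) → ∑ n F ≈ ∑ n G
∑-cong n p = ≈[]⇒≈ (λ N → ∑-cong[] n (λ i i<n → ≈⇒≈[] (p i i<n)))

∏-cong : ∀ {F G} n → (∀ i → F i ≈ G i) → ∏ n F ≈ ∏ n G
∏-cong zero    p = refl
∏-cong (suc n) p = ·-cong (∏-cong n p) (p n)

∑-∔ : ∀ n F G → ∑ n (λ i → F i ∔ G i) ≈ ∑ n F ∔ ∑ n G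
∑-∔ zero    F G = sym (∔-identityˡ 𝟘)
∑-∔ (suc n) F G = trans (∔-congʳ (∑-∔ n F G))
  (solve 4 (λ a b c d → (a :+ b) :+ (c :+ d) := (a :+ c) :+ (b :+ d)) refl (∑ n F) (∑ n G) (F n) (G n))

∑-distribˡ : ∀ n h F → h · ∑ n F ≈ ∑ n (λ i → h · F i)
∑-distribˡ zero    h F = ·-zeroʳ h
∑-distribˡ (suc n) h F = trans (·-distribˡ-∔ h (∑ n F) (F n)) (∔-congʳ (∑-distribˡ n h F))

∑-head : ∀ n F → ∑ (suc n) F ≈ F 0 ∔ ∑ n (λ i → F (suc i))
∑-head zero    F = ∔-comm 𝟘 (F 0)
∑-head (suc n) F = trans (∔-congʳ (∑-head n F)) (∔-assoc _ _ _)

∏-head : ∀ n F → ∏ (suc n) F ≈ F 0 · ∏ n (λ i → F (suc i))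
∏-head zero    F = ·-comm 𝟙 (F 0)
∏-head (suc n) F = trans (·-congʳ (∏-head n F)) (·-assoc _ _ _)

∑-square : ∀ n F → ∑ n F · ∑ n F ≈ ∑ n (λ i → F i · F i)
∑-square zero    F = ·-zeroʳ 𝟘
∑-square (suc n) F = trans (solve 2 (λ a b → (a :+ b) :* (a :+ b) := a :* a :+ b :* b) refl (∑ n F) (F n)) (∔-congʳ (∑-square n F))

∏-square : ∀ n F → ∏ n F · ∏ n F ≈ ∏ n (λ i → F i · F i)
∏-square zero    F = ·-identityʳ 𝟙
∏-square (suc n) F = trans (solve 2 (λ a b → (a :* b) :* (a :* b) := (a :* a) :* (b :* b)) refl (∏ n F) (F n)) (·-congʳ (∏-square n F))

∏-inverse : ∀ n F G → (∀ i → F i · G i ≈ 𝟙) → ∏ n F · ∏ n G ≈ 𝟙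
∏-inverse zero    F G p = ·-identityʳ 𝟙
∏-inverse (suc n) F G p = begin
  (∏ n F · F n) · (∏ n G · G n) ≈⟨ solve 4 (λ a b c d → (a :* b) :* (c :* d) := (a :* c) :* (b :* d)) refl (∏ n F) (F n) (∏ n G) (G n) ⟩
  (∏ n F · ∏ n G) · (F n · G n) ≈⟨ ·-cong (∏-inverse n F G p) (p n) ⟩
  𝟙 · 𝟙                        ≈⟨ ·-identityʳ 𝟙 ⟩
  𝟙 ∎
  where open ≈-Reasoning

dil-∑ : ∀ k n F → dil (suc k) (∑ n F) ≈ ∑ n (λ i → dil (suc k) (F i))
dil-∑ k zero    F = mk≈ h
  where
  h : ∀ n → dil (suc k) 𝟘 n ≡ 0ℙ
  h n with n % suc k ≡ᵇ 0
  ... | Bool.true  = ≡.refl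
  ... | Bool.false = ≡.refl
dil-∑ k (suc n) F = trans (dil-∔ (suc k) (∑ n F) (F n)) (∔-congʳ (dil-∑ k n F))

dil-∏ : ∀ k n F → dil (suc k) (∏ n F) ≈ ∏ n (λ i → dil (suc k) (F i))
dil-∏ k zero    F = dil-𝟙 k
dil-∏ k (suc n) F = trans (dil-· k (∏ n F) (F n)) (·-congʳ (dil-∏ k n F))

∑-stable : ∀ {F N M} k → (∀ i → F i ≈[ i ] 𝟘) → N ≤ M → ∑ (k + M) F ≈[ N ] ∑ M F
∑-stable         zero    p N≤M = refl[]
∑-stable {F} {N} {M} (suc k) p N≤M = begin
  ∑ (k + M) F ∔ F (k + M) ≈⟨ ∔-cong[] (∑-stable k p N≤M) (weaken (≤-trans N≤M (m≤n+m M k)) (p (k + M))) ⟩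
  ∑ M F ∔ 𝟘               ≈⟨ ≈⇒≈[] (∔-identityʳ (∑ M F)) ⟩
  ∑ M F                   ∎
  where open ≈[]-Reasoning N

∏-stable : ∀ {F N M} k → (∀ i → F i ≈[ i ] 𝟙) → N ≤ M → ∏ (k + M) F ≈[ N ] ∏ M F
∏-stable         zero    p N≤M = refl[]
∏-stable {F} {N} {M} (suc k) p N≤M = begin
  ∏ (k + M) F · F (k + M) ≈⟨ ·-cong[] (∏-stable k p N≤M) (weaken (≤-trans N≤M (m≤n+m M k)) (p (k + M))) ⟩
  ∏ M F · 𝟙               ≈⟨ ≈⇒≈[] (·-identityʳ (∏ M F)) ⟩
  ∏ M F                   ∎
  where open ≈[]-Reasoning N

-- Coefficient n uses n + 1 terms, and the later ones are divisible by q^(n+1); hence every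
-- truncation with at least `N` terms is right below q^N.
∑∞≈∑ : ∀ {F N M} → (∀ i → F i ≈[ i ] 𝟘) → N ≤ M → ∑∞ F ≈[ N ] ∑ M F
∑∞≈∑ {F} {N} {M} p N≤M = mk≈[] λ n n<N → h n (≤-trans n<N N≤M)
  where
  h : ∀ n → n < M → ∑ (suc n) F n ≡ ∑ M F n
  h n n<M with k , ≡.refl ← m≤n⇒∃[o]m+o≡n n<M =
    ≡.trans (≡.sym (below (∑-stable {F} {suc n} k p ≤-refl) n ≤-refl)) (cong (λ m → ∑ m F n) (+-comm k (suc n)))

∏∞≈∏ : ∀ {F N M} → (∀ i → F i ≈[ i ] 𝟙) → N ≤ M → ∏∞ F ≈[ N ] ∏ M F
∏∞≈∏ {F} {N} {M} p N≤M = mk≈[] λ n n<N → h n (≤-trans n<N N≤M)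
  where
  h : ∀ n → n < M → ∏ (suc n) F n ≡ ∏ M F n
  h n n<M with k , ≡.refl ← m≤n⇒∃[o]m+o≡n n<M =
    ≡.trans (≡.sym (below (∏-stable {F} {suc n} k p ≤-refl) n ≤-refl)) (cong (λ m → ∏ m F n) (+-comm k (suc n)))

-- q-products

T : ℕ → ℕ
T zero    = 0
T (suc n) = suc n + T n

-- (q;q)ₙ, 1/(q;q)ₙ, (q;q²)ₙ and, with n + 1 factors, 1/(q;q²)ₙ₊₁
Q R O β : ℕ → Ser
Q n = ∏ n (λ i → 𝟙 ∔ X^ suc i)
R n = ∏ n (λ i → geo (suc i))
O n = ∏ n (λ i → 𝟙 ∔ X^ suc (2 * i))
β n = ∏ (suc n) (λ i → geo (suc (2 * i)))

-- `𝒩` is the reduction modulo 2 of the third-order mock theta function ν(q) = Σ q^(n(n+1)) /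
-- (-q;q²)ₙ₊₁.
e r ψ 𝒩 : Ser
e = ∏∞ (λ i → 𝟙 ∔ X^ suc i)
r = ∏∞ (λ i → geo (suc i))
ψ = ∑∞ (λ i → X^ T i)
𝒩 = ∑∞ (λ n → X^ (n * suc n) · β n)

X^·X^ : ∀ {a b c} → a + b ≡ c → X^ a · X^ b ≈ X^ c
X^·X^ {a} {b} p = trans (sym (X^-+ a b)) (X^-cong p)

X^·X^·X^ : ∀ {a b c d} → a + b + c ≡ d → X^ a · X^ b · X^ c ≈ X^ d
X^·X^·X^ {a} {b} p = trans (·-congʳ (sym (X^-+ a b))) (X^·X^ p)

X^≈𝟘 : ∀ {k N} → N ≤ k → X^ k ≈[ N ] 𝟘
X^≈𝟘 {k} N≤k = trans[] (≈⇒≈[] (sym (·-identityʳ (X^ k)))) (X^·≈𝟘 𝟙 N≤k)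

1+X^≈𝟙 : ∀ {k N} → N ≤ k → 𝟙 ∔ X^ k ≈[ N ] 𝟙
1+X^≈𝟙 {k} {N} N≤k = trans[] (∔-cong[] refl[] (X^≈𝟘 N≤k)) (≈⇒≈[] (∔-identityʳ 𝟙))

geo≈𝟙 : ∀ {k N} → N ≤ suc k → geo (suc k) ≈[ N ] 𝟙
geo≈𝟙 {k} {N} N≤k = trans[] (≈⇒≈[] (dil-horner (suc k) ones))
  (trans[] (∔-cong[] refl[] (X^·≈𝟘 (geo (suc k)) N≤k)) (≈⇒≈[] (∔-identityʳ 𝟙)))

e≈Q : ∀ {N M} → N ≤ M → e ≈[ N ] Q M
e≈Q = ∏∞≈∏ (λ i → 1+X^≈𝟙 (n≤1+n i))

r≈R : ∀ {N M} → N ≤ M → r ≈[ N ] R M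
r≈R = ∏∞≈∏ (λ i → geo≈𝟙 (n≤1+n i))

n≤T : ∀ n → n ≤ T n
n≤T zero    = z≤n
n≤T (suc n) = m≤m+n (suc n) (T n)

ψ-summable : ∀ i → X^ T i ≈[ i ] 𝟘
ψ-summable i = X^≈𝟘 (n≤T i)

𝒩-summable : ∀ i → X^ (i * suc i) · β i ≈[ i ] 𝟘
𝒩-summable i = X^·≈𝟘 (β i) (m≤m*n i (suc i))

Q·R : ∀ n → Q n · R n ≈ 𝟙
Q·R n = ∏-inverse n _ _ geo-inverse

O·β : ∀ n → O (suc n) · β n ≈ 𝟙
O·β n = ∏-inverse (suc n) _ _ (λ i → geo-inverse (2 * i))

e·r : e · r ≈ 𝟙
e·r = ≈[]⇒≈ λ N → trans[] (·-cong[] (e≈Q ≤-refl) (r≈R ≤-refl)) (≈⇒≈[] (Q·R N))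

geo-cancel : ∀ k f → (𝟙 ∔ X^ suc k) · (f · geo (suc k)) ≈ f
geo-cancel k f = begin
  (𝟙 ∔ X^ suc k) · (f · geo (suc k)) ≈⟨ solve 3 (λ a f g → a :* (f :* g) := f :* (a :* g)) refl (𝟙 ∔ X^ suc k) f (geo (suc k)) ⟩
  f · ((𝟙 ∔ X^ suc k) · geo (suc k)) ≈⟨ ·-congˡ (geo-inverse k) ⟩
  f · 𝟙                             ≈⟨ ·-identityʳ f ⟩
  f ∎
  where open ≈-Reasoning

R-suc : ∀ n → R n ≈ (𝟙 ∔ X^ suc n) · R (suc n)
R-suc n = sym (geo-cancel n (R n))

X^-square : ∀ k → X^ (2 * k) ≈ X^ k · X^ k
X^-square k = sym (X^·X^ (cong (λ j → k + j) (≡.sym (+-identityʳ k))))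

-- The factors with odd exponent form `O n`; those with even exponent are squares, 1 + q^(2i) = (1 +
-- q^i)².
Q-double : ∀ n → Q (2 * n) ≈ O n · (Q n · Q n)
Q-double zero    = sym (trans (·-congˡ (·-identityʳ 𝟙)) (·-identityʳ 𝟙))
Q-double (suc n) = begin
  Q (2 * suc n)
    ≈⟨ reflexive (cong Q (+-suc (suc n) (n + 0))) ⟩
  Q (2 * n) · (𝟙 ∔ X^ suc (2 * n)) · (𝟙 ∔ X^ (2 + 2 * n))
    ≈⟨ ·-cong (·-congʳ (Q-double n)) (∔-congˡ (trans (X^-cong (≡.sym (*-suc 2 n))) (X^-square (suc n)))) ⟩
  O n · (Q n · Q n) · (𝟙 ∔ X^ suc (2 * n)) · (𝟙 ∔ X^ suc n · X^ suc n)
    ≈⟨ solve 4 (λ o q a b → o :* (q :* q) :* a :* (con 1ℙ :+ b :* b) := (o :* a) :* ((q :* (con 1ℙ :+ b)) :* (q :* (con 1ℙ :+ b))))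
       refl (O n) (Q n) (𝟙 ∔ X^ suc (2 * n)) (X^ suc n) ⟩
  O (suc n) · (Q (suc n) · Q (suc n)) ∎
  where open ≈-Reasoning

-- By `Q-double`, (q;q²)∞ is e / e². This is Euler's theorem on odd and distinct parts, read modulo
-- 2.
O≈r : ∀ {N M} → N ≤ M → O M ≈[ N ] r
O≈r {N} {M} N≤M = begin
  O M                                ≈⟨ ≈⇒≈[] (sym O-solved) ⟩
  Q (2 * M) · (R M · R M)            ≈⟨ ·-cong[] (sym[] (e≈Q (≤-trans N≤M (m≤n*m M 2)))) (·-cong[] (sym[] (r≈R N≤M)) (sym[] (r≈R N≤M))) ⟩
  e · (r · r)                        ≈⟨ ≈⇒≈[] (trans (sym (·-assoc e r r)) (trans (·-congʳ e·r) (·-identityˡ r))) ⟩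
  r ∎
  where
  open ≈[]-Reasoning N
  O-solved : Q (2 * M) · (R M · R M) ≈ O M
  O-solved = trans (·-congʳ (Q-double M)) (trans
    (solve 3 (λ o q s → o :* (q :* q) :* (s :* s) := o :* ((q :* s) :* (q :* s))) refl (O M) (Q M) (R M))
    (trans (·-congˡ (trans (·-cong (Q·R M) (Q·R M)) (·-identityʳ 𝟙))) (·-identityʳ (O M))))

β≈e : ∀ {N M} → N ≤ suc M → β M ≈[ N ] e
β≈e {N} {M} N≤M = begin
  β M              ≈⟨ ≈⇒≈[] (sym (trans (·-congʳ e·r) (·-identityˡ (β M)))) ⟩
  e · r · β M      ≈⟨ ·-cong[] (·-cong[] refl[] (sym[] (O≈r N≤M))) refl[] ⟩
  e · O (suc M) · β M ≈⟨ ≈⇒≈[] (trans (·-assoc e (O (suc M)) (β M)) (trans (·-congˡ (O·β M)) (·-identityʳ e))) ⟩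
  e ∎
  where open ≈[]-Reasoning N

-- Durfee rectangles

rect : ℕ → ℕ → Ser
rect m n = X^ (n * (n + m)) · R n · R (n + m)

n≤n*[n+m] : ∀ n m → n ≤ n * (n + m)
n≤n*[n+m] zero    m = z≤n
n≤n*[n+m] (suc n) m = m≤m*n (suc n) (suc n + m)

-- With x, y, z as below, the old remainder and the new term add up to (xy + xyz)
-- `R n · R (suc (n + m))`: the part with xy is the next term for m + 1, the part with xyz the new
-- remainder. Its factor `𝟙 ∔ X^ N` makes the remainder start from zero.
rect-telescope : ∀ N m → ∑ N (rect m) ≈ ∑ N (rect (suc m)) ∔ X^ (N * (N + m)) · (𝟙 ∔ X^ N) · R N · R (N + m)
rect-telescope zero    m = sym (trans (∔-identityˡ _) (trans (·-congʳ (·-congʳ (·-congˡ (∔-congˡ X^-zero)))) (trans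
  (solve 2 (λ x s → x :* (con 1ℙ :+ con 1ℙ) :* con 1ℙ :* s := s :+ s) refl (X^ 0) (R m)) (f∔f≈𝟘 (R m)))))
rect-telescope (suc n) m = begin
  ∑ n (rect m) ∔ x · R n · R (n + m)
    ≈⟨ ∔-cong (rect-telescope n m) (·-congˡ (R-suc (n + m))) ⟩
  (∑ n (rect (suc m)) ∔ x · (𝟙 ∔ y) · R n · R (n + m)) ∔ x · R n · ((𝟙 ∔ z) · R (suc (n + m)))
    ≈⟨ ∔-congʳ (∔-congˡ (·-congˡ (R-suc (n + m)))) ⟩
  (∑ n (rect (suc m)) ∔ x · (𝟙 ∔ y) · R n · ((𝟙 ∔ z) · R (suc (n + m)))) ∔ x · R n · ((𝟙 ∔ z) · R (suc (n + m)))
    ≈⟨ solve 6 (λ s x y z a b → (s :+ x :* (con 1ℙ :+ y) :* a :* ((con 1ℙ :+ z) :* b)) :+ x :* a :* ((con 1ℙ :+ z) :* b)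
                 := (s :+ (x :* y) :* a :* b) :+ (x :* y :* z) :* a :* b) refl (∑ n (rect (suc m))) x y z (R n) (R (suc (n + m))) ⟩
  (∑ n (rect (suc m)) ∔ (x · y) · R n · R (suc (n + m))) ∔ (x · y · z) · R n · R (suc (n + m))
    ≈⟨ ∔-cong (∔-congˡ (·-cong (·-congʳ (X^·X^ (exp₁ n m))) (reflexive (cong R (≡.sym (+-suc n m))))))
              (·-congʳ (·-cong (X^·X^·X^ (exp₂ n m)) (R-suc n))) ⟩
  (∑ (suc n) (rect (suc m))) ∔ X^ (suc n * (suc n + m)) · ((𝟙 ∔ X^ suc n) · R (suc n)) · R (suc n + m)
    ≈⟨ ∔-congˡ (·-congʳ (sym (·-assoc (X^ (suc n * (suc n + m))) (𝟙 ∔ X^ suc n) (R (suc n))))) ⟩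
  ∑ (suc n) (rect (suc m)) ∔ X^ (suc n * (suc n + m)) · (𝟙 ∔ X^ suc n) · R (suc n) · R (suc n + m) ∎
  where
  open ≈-Reasoning
  x y z : Ser
  x = X^ (n * (n + m)) ; y = X^ n ; z = X^ suc (n + m)
  exp₁ : ∀ n m → n * (n + m) + n ≡ n * (n + suc m)
  exp₁ = solve-∀
  exp₂ : ∀ n m → n * (n + m) + n + suc (n + m) ≡ suc n * (suc n + m)
  exp₂ = solve-∀

rect-suc : ∀ N m → ∑ N (rect m) ≈[ N ] ∑ N (rect (suc m))
rect-suc N m = trans[] (≈⇒≈[] (rect-telescope N m)) (trans[]
  (∔-cong[] refl[] (trans[] (≈⇒≈[] (trans (·-assoc _ _ _) (·-assoc _ _ _))) (X^·≈𝟘 _ (n≤n*[n+m] N m)))) (≈⇒≈[] (∔-identityʳ _)))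

rect-+ : ∀ N k m → ∑ N (rect m) ≈[ N ] ∑ N (rect (k + m))
rect-+ N zero    m = refl[]
rect-+ N (suc k) m = trans[] (rect-+ N k m) (rect-suc N (k + m))

-- Modulo q^N the sum does not depend on the offset, which can therefore be pushed beyond `N`. There
-- all terms with n ≥ 1 vanish, and the term n = 0 is `R` at a large index.
durfee : ∀ N m → ∑ N (rect m) ≈[ N ] r
durfee zero    m = mk≈[] λ _ ()
durfee (suc N) m = begin
  ∑ (suc N) (rect m)          ≈⟨ rect-+ (suc N) (suc N) m ⟩
  ∑ (suc N) (rect (suc N + m)) ≈⟨ ≈⇒≈[] (∑-head N (rect (suc N + m))) ⟩
  rect (suc N + m) 0 ∔ ∑ N (λ n → rect (suc N + m) (suc n))
    ≈⟨ ∔-cong[] (≈⇒≈[] (trans (·-congʳ (·-congʳ X^-zero)) (solve 1 (λ s → con 1ℙ :* con 1ℙ :* s := s) refl (R (suc N + m)))))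
                (∑-cong[] N (λ n _ → trans[] (≈⇒≈[] (·-assoc _ _ _)) (X^·≈𝟘 _ (large n)))) ⟩
  R (suc N + m) ∔ ∑ N (λ _ → 𝟘) ≈⟨ ∔-cong[] (sym[] (r≈R (m≤m+n (suc N) m))) (≈⇒≈[] (∑-𝟘 N)) ⟩
  r ∔ 𝟘                        ≈⟨ ≈⇒≈[] (∔-identityʳ r) ⟩
  r ∎
  where
  open ≈[]-Reasoning (suc N)
  large : ∀ n → suc N ≤ suc n * (suc n + (suc N + m))
  large n = ≤-trans (m≤m+n (suc N) m) (≤-trans (m≤n+m (suc N + m) (suc n)) (m≤n*m (suc n + (suc N + m)) (suc n)))
  ∑-𝟘 : ∀ N → ∑ N (λ _ → 𝟘) ≈ 𝟘
  ∑-𝟘 zero    = refl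
  ∑-𝟘 (suc N) = trans (∔-identityʳ _) (∑-𝟘 N)

-- Gauss' identity

-- The triangular number (n - 1) n / 2 of the preceding index; 0 is its true value at n = 0.
T⁻ : ℕ → ℕ
T⁻ zero    = 0
T⁻ (suc n) = T n

T≡n+T⁻ : ∀ n → T n ≡ n + T⁻ n
T≡n+T⁻ zero    = ≡.refl
T≡n+T⁻ (suc n) = ≡.refl

gaussTerm : ℕ → ℕ → Ser
gaussTerm n s = X^ T s · R (n ∸ s) · R (n + suc s)

module GaussStep (n-1 : ℕ) where
  n : ℕ
  n = suc n-1

  w w²X : Ser
  w   = X^ n
  w²X = X^ suc (2 * n)

  -- A certificate in the sense of Zeilberger: for s < n, `step s` is the difference of `V (suc s)`
  -- and `V s`. The two powers of q coincide at s = 0, so the telescoping starts from zero.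
  V : ℕ → Ser
  V s = w · (X^ T s ∔ X^ T⁻ s) · R (n ∸ s) · R (n + s)

  step : ℕ → Ser
  step s = (𝟙 ∔ w) · ((𝟙 ∔ w²X) · gaussTerm n s ∔ gaussTerm n-1 s)

  -- The factor 𝟙 ∔ w, cancelled in the end, is what makes the summand telescope.
  V-step : ∀ s → s < n → V s ∔ step s ≈ V (suc s)
  V-step s s<n with j , ≡.refl ← m≤n⇒∃[o]m+o≡n (s≤s⁻¹ s<n) = begin
    V s ∔ step s
      ≈⟨ ∔-cong (·-cong (·-cong (·-cong w≈ (∔-congʳ τ≈)) A≈) (trans (R-suc (n + s)) (·-cong (∔-congˡ z≈) B≈)))
          (·-cong (∔-congˡ w≈) (∔-cong (·-cong (∔-congˡ w²≈) (·-congʳ (·-cong τ≈ A≈)))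
            (·-cong (·-cong τ≈ (trans (reflexive (cong R (m+n∸m≡n s j))) (R-suc j)))
                    (trans (reflexive (cong R (+-suc n-1 s))) (trans (R-suc (n + s)) (·-cong (∔-congˡ z≈) B≈)))))) ⟩
    (u · v) · (u · τ ∔ τ) · A · ((𝟙 ∔ u · v · u · x) · B)
      ∔ (𝟙 ∔ u · v) · ((𝟙 ∔ u · v · (u · v) · x) · (u · τ · A · B) ∔ u · τ · ((𝟙 ∔ v) · A) · ((𝟙 ∔ u · v · u · x) · B))
      ≈⟨ solve 6 (λ u v x τ A B →
           (u :* v) :* (u :* τ :+ τ) :* A :* ((con 1ℙ :+ u :* v :* u :* x) :* B)
             :+ (con 1ℙ :+ u :* v) :* ((con 1ℙ :+ u :* v :* (u :* v) :* x) :* (u :* τ :* A :* B)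
                :+ u :* τ :* ((con 1ℙ :+ v) :* A) :* ((con 1ℙ :+ u :* v :* u :* x) :* B))
           := (u :* v) :* (x :* u :* (u :* τ) :+ u :* τ) :* ((con 1ℙ :+ v) :* A) :* B) refl u v x τ A B ⟩
    (u · v) · (x · u · (u · τ) ∔ u · τ) · ((𝟙 ∔ v) · A) · B
      ≈⟨ ·-congʳ (·-cong (·-cong (sym w≈) (∔-cong T-suc (sym τ≈)))
                         (trans (sym (R-suc j)) (reflexive (cong R (≡.sym (m+n∸m≡n s j)))))) ⟩
    V (suc s) ∎
    where
    open ≈-Reasoning
    -- Since n = s + j + 1, every exponent is a combination of s, j + 1, 1 and `T⁻ s`, and the claim
    -- becomes a polynomial identity in these six atoms.
    u v x τ A B : Ser
    u = X^ s ; v = X^ suc j ; x = X^ 1 ; τ = X^ T⁻ s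
    A = R (suc j) ; B = R (n + suc s)
    w≈ : w ≈ u · v
    w≈ = sym (X^·X^ (+-suc s j))
    τ≈ : X^ T s ≈ u · τ
    τ≈ = trans (X^-cong (T≡n+T⁻ s)) (X^-+ s (T⁻ s))
    A≈ : R (n ∸ s) ≈ A
    A≈ = reflexive (cong R (≡.trans (cong (_∸ s) (≡.sym (+-suc s j))) (m+n∸m≡n s (suc j))))
    B≈ : R (suc (n + s)) ≈ B
    B≈ = reflexive (cong R (≡.sym (+-suc n s)))
    z≈ : X^ suc (n + s) ≈ u · v · u · x
    z≈ = sym (trans (·-congʳ (X^·X^·X^ ≡.refl)) (X^·X^ (exp s j)))
      where
      exp : ∀ s j → s + suc j + s + 1 ≡ suc (suc (s + j) + s)
      exp = solve-∀
    w²≈ : w²X ≈ u · v · (u · v) · x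
    w²≈ = sym (trans (·-congʳ (trans (·-cong (X^·X^ ≡.refl) (X^·X^ ≡.refl)) (X^·X^ ≡.refl))) (X^·X^ (exp s j)))
      where
      exp : ∀ s j → s + suc j + (s + suc j) + 1 ≡ suc (2 * suc (s + j))
      exp = solve-∀
    T-suc : x · u · (u · τ) ≈ X^ T (suc s)
    T-suc = trans (·-cong (X^·X^ ≡.refl) (sym τ≈)) (X^·X^ ≡.refl)

  V-zero : V 0 ≈ 𝟘
  V-zero = trans (·-congʳ (trans (·-congʳ (trans (·-congˡ (f∔f≈𝟘 (X^ 0))) (·-zeroʳ w))) (·-zeroˡ _))) (·-zeroˡ _)

  ∑step : ∀ m → m ≤ n → ∑ m step ≈ V m
  ∑step zero    _   = sym V-zero
  ∑step (suc m) m<n = trans (∔-congʳ (∑step m (<⇒≤ m<n))) (V-step m m<n)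

  -- The summand s = n has no partner in the sum for n - 1; the boundary value `V n` compensates
  -- exactly for it.
  last : V n ∔ (𝟙 ∔ w) · ((𝟙 ∔ w²X) · gaussTerm n n) ≈ 𝟘
  last = begin
    V n ∔ (𝟙 ∔ w) · ((𝟙 ∔ w²X) · gaussTerm n n)
      ≈⟨ ∔-cong (·-cong (·-cong (·-congˡ (∔-congʳ τ≈)) R0) (trans (R-suc (n + n)) (·-cong (∔-congˡ (X^-cong 2n+1)) B≈)))
                (·-congˡ (·-congˡ (·-congʳ (·-cong τ≈ R0)))) ⟩
    w · (w · τ ∔ τ) · 𝟙 · ((𝟙 ∔ w²X) · B) ∔ (𝟙 ∔ w) · ((𝟙 ∔ w²X) · (w · τ · 𝟙 · B))
      ≈⟨ solve 4 (λ w z τ B → w :* (w :* τ :+ τ) :* con 1ℙ :* ((con 1ℙ :+ z) :* B) :+ (con 1ℙ :+ w) :* ((con 1ℙ :+ z) :* (w :* τ :* con 1ℙ :* B))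
               := B :+ B) refl w w²X τ B ⟩
    B ∔ B ≈⟨ f∔f≈𝟘 B ⟩
    𝟘 ∎
    where
    open ≈-Reasoning
    τ B : Ser
    τ = X^ T⁻ n ; B = R (n + suc n)
    τ≈ : X^ T n ≈ w · τ
    τ≈ = trans (X^-cong (T≡n+T⁻ n)) (X^-+ n (T⁻ n))
    R0 : R (n ∸ n) ≈ 𝟙
    R0 = reflexive (cong R (n∸n≡0 n))
    2n+1 : suc (n + n) ≡ suc (2 * n)
    2n+1 = cong (λ k → suc (n + k)) (≡.sym (+-identityʳ n))
    B≈ : R (suc (n + n)) ≈ B
    B≈ = reflexive (cong R (≡.sym (+-suc n n)))

  -- Summing `step` gives `V n`, which `last` cancels. This proves the relation multiplied by 1 +
  -- q^n, a unit that `geo-cancel` removes.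
  recurrence : (𝟙 ∔ w²X) · ∑ (suc n) (gaussTerm n) ≈ ∑ n (gaussTerm n-1)
  recurrence = ∔≈𝟘⇒≈ (begin
    D                          ≈⟨ geo-cancel n-1 D ⟨
    (𝟙 ∔ w) · (D · geo n)      ≈⟨ sym (·-assoc _ _ _) ⟩
    (𝟙 ∔ w) · D · geo n        ≈⟨ ·-congʳ killed ⟩
    𝟘 · geo n                  ≈⟨ ·-zeroˡ (geo n) ⟩
    𝟘                          ∎)
    where
    open ≈-Reasoning
    D : Ser
    D = (𝟙 ∔ w²X) · ∑ (suc n) (gaussTerm n) ∔ ∑ n (gaussTerm n-1)
    killed : (𝟙 ∔ w) · D ≈ 𝟘
    killed = begin
      (𝟙 ∔ w) · D
        ≈⟨ solve 5 (λ a b s t g → a :* (b :* (s :+ g) :+ t) := a :* (b :* s :+ t) :+ a :* (b :* g)) refl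
             (𝟙 ∔ w) (𝟙 ∔ w²X) (∑ n (gaussTerm n)) (∑ n (gaussTerm n-1)) (gaussTerm n n) ⟩
      (𝟙 ∔ w) · ((𝟙 ∔ w²X) · ∑ n (gaussTerm n) ∔ ∑ n (gaussTerm n-1)) ∔ (𝟙 ∔ w) · ((𝟙 ∔ w²X) · gaussTerm n n)
        ≈⟨ ∔-congʳ (trans (·-congˡ (trans (∔-congʳ (∑-distribˡ n (𝟙 ∔ w²X) (gaussTerm n))) (sym (∑-∔ n _ _)))) (∑-distribˡ n (𝟙 ∔ w) _)) ⟩
      ∑ n step ∔ (𝟙 ∔ w) · ((𝟙 ∔ w²X) · gaussTerm n n)
        ≈⟨ ∔-congʳ (∑step n ≤-refl) ⟩
      V n ∔ (𝟙 ∔ w) · ((𝟙 ∔ w²X) · gaussTerm n n)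
        ≈⟨ last ⟩
      𝟘 ∎

gauss : ∀ n → ∑ (suc n) (gaussTerm n) ≈ β n
gauss zero    = trans (∔-identityˡ _) (trans (·-congʳ (·-congʳ X^-zero)) (trans (·-congʳ (·-identityˡ 𝟙)) (·-identityˡ (R 1))))
gauss (suc n) = begin
  S                                                   ≈⟨ geo-cancel (2 * suc n) S ⟨
  (𝟙 ∔ X^ suc (2 * suc n)) · (S · geo (suc (2 * suc n))) ≈⟨ ·-assoc _ _ _ ⟨
  (𝟙 ∔ X^ suc (2 * suc n)) · S · geo (suc (2 * suc n))   ≈⟨ ·-congʳ (trans (GaussStep.recurrence n) (gauss n)) ⟩
  β (suc n) ∎
  where
  open ≈-Reasoning
  S : Ser
  S = ∑ (suc (suc n)) (gaussTerm (suc n))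

-- Let n grow in `gauss`: for fixed s the two factors `R` become r², while `β n` becomes `e`.
r·r·ψ≈e : r · r · ψ ≈ e
r·r·ψ≈e = ≈[]⇒≈ λ N → let open ≈[]-Reasoning N in begin
  r · r · ψ                                   ≈⟨ ·-cong[] refl[] (∑∞≈∑ ψ-summable (n≤1+n N)) ⟩
  r · r · ∑ (suc N) (λ i → X^ T i)            ≈⟨ ≈⇒≈[] (∑-distribˡ (suc N) (r · r) (λ i → X^ T i)) ⟩
  ∑ (suc N) (λ i → r · r · X^ T i)            ≈⟨ ∑-cong[] (suc N) (λ s s≤N → sym[] (limit N s (s≤s⁻¹ s≤N))) ⟩
  ∑ (suc N) (gaussTerm N)                     ≈⟨ ≈⇒≈[] (gauss N) ⟩
  β N                                         ≈⟨ β≈e (n≤1+n N) ⟩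
  e                                           ∎
  where
  limit : ∀ N s → s ≤ N → gaussTerm N s ≈[ N ] r · r · X^ T s
  limit N s s≤N = begin
    X^ T s · R (N ∸ s) · R (N + suc s)  ≈⟨ ·-cong[] (weaken N≤ (X^·-cong[] (T s) (sym[] (r≈R ≤-refl)))) (sym[] (r≈R (m≤m+n N (suc s)))) ⟩
    X^ T s · r · r                      ≈⟨ ≈⇒≈[] (trans (·-assoc _ _ _) (·-comm _ _)) ⟩
    r · r · X^ T s                      ∎
    where
    open ≈[]-Reasoning N
    -- `R (N ∸ s)` agrees with `r` only below q^(N-s); the factor `X^ T s` makes up for the loss
    -- because s ≤ T(s).
    N≤ : N ≤ T s + (N ∸ s)
    N≤ = ≤-trans (≤-reflexive (≡.sym (m+[n∸m]≡n s≤N))) (+-monoˡ-≤ (N ∸ s) (n≤T s))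

e³≈ψ : e ↑ 3 ≈ ψ
e³≈ψ = begin
  e ↑ 3                     ≈⟨ solve 1 (λ e → e :^ 3 := e :* e :* e) refl e ⟩
  e · e · e                 ≈⟨ ·-congˡ r·r·ψ≈e ⟨
  e · e · (r · r · ψ)       ≈⟨ solve 3 (λ e r p → e :* e :* (r :* r :* p) := (e :* r) :* (e :* r) :* p) refl e r ψ ⟩
  (e · r) · (e · r) · ψ     ≈⟨ ·-congʳ (trans (·-cong e·r e·r) (·-identityʳ 𝟙)) ⟩
  𝟙 · ψ                     ≈⟨ ·-identityˡ ψ ⟩
  ψ                         ∎
  where open ≈-Reasoning

-- The pentagonal number theorem, after Shanks, and the cubic identity

shanksTerm : ℕ → ℕ → Ser
shanksTerm n s = X^ (s * n + T s) · Q n · R s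

-- The generalised pentagonal numbers k(3k - 1)/2 and k(3k + 1)/2 at k = n + 1.
pent⁻ pent⁺ : ℕ → ℕ
pent⁻ n = n * suc n + T (suc n)
pent⁺ n = suc n * suc n + T (suc n)

shanks-telescope : ∀ n m → ∑ m (shanksTerm (suc n)) ∔ ∑ m (shanksTerm n) ≈ X^ (m * n + T m) · (𝟙 ∔ X^ m) · Q n · R m
shanks-telescope n zero = trans (f∔f≈𝟘 𝟘) (sym (trans (·-congʳ (·-congʳ (·-congˡ (∔-congˡ X^-zero))))
  (trans (solve 2 (λ x q → x :* (con 1ℙ :+ con 1ℙ) :* q :* con 1ℙ := x :+ x) refl (X^ 0) (Q n)) (f∔f≈𝟘 (X^ 0)))))
shanks-telescope n (suc m) = begin
  (∑ m (shanksTerm (suc n)) ∔ shanksTerm (suc n) m) ∔ (∑ m (shanksTerm n) ∔ shanksTerm n m)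
    ≈⟨ solve 4 (λ a b c d → (a :+ b) :+ (c :+ d) := (a :+ c) :+ (b :+ d)) refl
         (∑ m (shanksTerm (suc n))) (shanksTerm (suc n) m) (∑ m (shanksTerm n)) (shanksTerm n m) ⟩
  (∑ m (shanksTerm (suc n)) ∔ ∑ m (shanksTerm n)) ∔ (shanksTerm (suc n) m ∔ shanksTerm n m)
    ≈⟨ ∔-cong (shanks-telescope n m) (∔-congʳ (·-congʳ (·-congʳ (sym (X^·X^ (exp₁ m n (T m))))))) ⟩
  x · (𝟙 ∔ y) · Q n · R m ∔ (x · y · (Q n · (𝟙 ∔ z)) · R m ∔ x · Q n · R m)
    ≈⟨ solve 5 (λ x y z q s → x :* (con 1ℙ :+ y) :* q :* s :+ (x :* y :* (q :* (con 1ℙ :+ z)) :* s :+ x :* q :* s)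
                 := x :* y :* z :* q :* s) refl x y z (Q n) (R m) ⟩
  x · y · z · Q n · R m
    ≈⟨ ·-cong (·-congʳ (X^·X^·X^ (exp₂ m n (T m)))) (R-suc m) ⟩
  X^ (suc m * n + T (suc m)) · Q n · ((𝟙 ∔ X^ suc m) · R (suc m))
    ≈⟨ solve 4 (λ x y q s → x :* q :* (y :* s) := x :* y :* q :* s) refl (X^ (suc m * n + T (suc m))) (𝟙 ∔ X^ suc m) (Q n) (R (suc m)) ⟩
  X^ (suc m * n + T (suc m)) · (𝟙 ∔ X^ suc m) · Q n · R (suc m) ∎
  where
  open ≈-Reasoning
  x y z : Ser
  x = X^ (m * n + T m) ; y = X^ m ; z = X^ suc n
  exp₁ : ∀ m n t → m * n + t + m ≡ m * suc n + t
  exp₁ = solve-∀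
  exp₂ : ∀ m n t → m * n + t + m + suc n ≡ suc m * n + (suc m + t)
  exp₂ = solve-∀

-- From n to n + 1 the first n + 1 terms change by `X^ pent⁻ n`, and the new last term is
-- `X^ pent⁺ n`; both simplify because `Q (suc n) · R (suc n)` is 1.
shanks : ∀ n → ∑ (suc n) (shanksTerm n) ≈ 𝟙 ∔ ∑ n (λ i → X^ pent⁻ i ∔ X^ pent⁺ i)
shanks zero    = trans (∔-comm 𝟘 _) (∔-congʳ (trans (·-congʳ (·-congʳ X^-zero)) (trans (·-congʳ (·-identityʳ 𝟙)) (·-identityʳ 𝟙))))
shanks (suc n) = begin
  ∑ (suc n) (shanksTerm (suc n)) ∔ shanksTerm (suc n) (suc n)
    ≈⟨ solve 3 (λ a b c → a :+ c := b :+ ((a :+ b) :+ c)) refl (∑ (suc n) (shanksTerm (suc n))) (∑ (suc n) (shanksTerm n)) (shanksTerm (suc n) (suc n)) ⟩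
  ∑ (suc n) (shanksTerm n) ∔ ((∑ (suc n) (shanksTerm (suc n)) ∔ ∑ (suc n) (shanksTerm n)) ∔ shanksTerm (suc n) (suc n))
    ≈⟨ ∔-cong (shanks n) (∔-cong (trans (shanks-telescope n (suc n)) first) second) ⟩
  (𝟙 ∔ ∑ n (λ i → X^ pent⁻ i ∔ X^ pent⁺ i)) ∔ (X^ pent⁻ n ∔ X^ pent⁺ n)
    ≈⟨ ∔-assoc _ _ _ ⟩
  𝟙 ∔ ∑ (suc n) (λ i → X^ pent⁻ i ∔ X^ pent⁺ i) ∎
  where
  open ≈-Reasoning
  first : X^ (suc n * n + T (suc n)) · (𝟙 ∔ X^ suc n) · Q n · R (suc n) ≈ X^ pent⁻ n
  first = trans (solve 4 (λ x y q s → x :* y :* q :* s := x :* (q :* y :* s)) refl (X^ (suc n * n + T (suc n))) (𝟙 ∔ X^ suc n) (Q n) (R (suc n)))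
    (trans (·-congˡ (Q·R (suc n))) (trans (·-identityʳ _) (X^-cong (cong (_+ T (suc n)) (*-comm (suc n) n)))))
  second : shanksTerm (suc n) (suc n) ≈ X^ pent⁺ n
  second = trans (·-assoc _ _ _) (trans (·-congˡ (Q·R (suc n))) (·-identityʳ _))

-- In the finite identity at n = N every term with s ≥ 1 is divisible by q^N, and the term s = 0 is
-- `Q N`.
pentagonal : ∀ N → e ≈[ N ] 𝟙 ∔ ∑ N (λ i → X^ pent⁻ i ∔ X^ pent⁺ i)
pentagonal N = begin
  e                                           ≈⟨ e≈Q ≤-refl ⟩
  Q N                                         ≈⟨ ≈⇒≈[] (sym (trans (·-congʳ (trans (·-congʳ X^-zero) (·-identityˡ (Q N)))) (·-identityʳ (Q N)))) ⟩
  shanksTerm N 0                              ≈⟨ ≈⇒≈[] (sym (∔-identityʳ _)) ⟩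
  shanksTerm N 0 ∔ 𝟘                          ≈⟨ ∔-cong[] refl[] (sym[] (small N ≤-refl)) ⟩
  shanksTerm N 0 ∔ ∑ N (λ s → shanksTerm N (suc s)) ≈⟨ ≈⇒≈[] (sym (∑-head N (shanksTerm N))) ⟩
  ∑ (suc N) (shanksTerm N)                    ≈⟨ ≈⇒≈[] (shanks N) ⟩
  𝟙 ∔ ∑ N (λ i → X^ pent⁻ i ∔ X^ pent⁺ i)     ∎
  where
  open ≈[]-Reasoning N
  small : ∀ M → M ≤ N → ∑ M (λ s → shanksTerm N (suc s)) ≈[ N ] 𝟘
  small zero    _ = refl[]
  small (suc M) M<N = trans[] (∔-cong[] (small M (<⇒≤ M<N))
    (trans[] (≈⇒≈[] (·-assoc _ _ _)) (X^·≈𝟘 _ (≤-trans (m≤m+n N (M * N)) (m≤m+n (suc M * N) (T (suc M)))))))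
    (≈⇒≈[] (∔-identityʳ 𝟘))

2T≡ : ∀ n → T n + T n ≡ n * suc n
2T≡ zero    = ≡.refl
2T≡ (suc n) = ≡.trans (exp₁ n (T n)) (≡.trans (cong (λ j → suc n + suc n + j) (2T≡ n)) (exp₂ n))
  where
  exp₁ : ∀ n t → (suc n + t) + (suc n + t) ≡ (suc n + suc n) + (t + t)
  exp₁ = solve-∀
  exp₂ : ∀ n → suc n + suc n + n * suc n ≡ suc n * suc (suc n)
  exp₂ = solve-∀

T[3n+1] : ∀ n → T (suc (n * 3)) ≡ suc (T n * 9)
T[3n+1] zero    = ≡.refl
T[3n+1] (suc n) = ≡.trans (cong (λ t → (4 + n * 3) + ((3 + n * 3) + ((2 + n * 3) + t))) (T[3n+1] n)) (exp n (T n))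
  where
  exp : ∀ n t → (4 + n * 3) + ((3 + n * 3) + ((2 + n * 3) + suc (t * 9))) ≡ suc ((suc n + t) * 9)
  exp = solve-∀

T[3n+2] : ∀ n → T (2 + n * 3) ≡ pent⁻ n * 3
T[3n+2] n = ≡.trans (cong (λ j → 2 + n * 3 + j) (T[3n+1] n)) (≡.trans (exp₁ n (T n)) (≡.trans (cong (λ k → 3 + n * 3 + T n * 3 + 3 * k) (2T≡ n)) (exp₂ n (T n))))
  where
  exp₁ : ∀ n t → 2 + n * 3 + suc (t * 9) ≡ 3 + n * 3 + t * 3 + 3 * (t + t)
  exp₁ = solve-∀
  exp₂ : ∀ n t → 3 + n * 3 + t * 3 + 3 * (n * suc n) ≡ (n * suc n + (suc n + t)) * 3
  exp₂ = solve-∀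

T[3n+3] : ∀ n → T (3 + n * 3) ≡ pent⁺ n * 3
T[3n+3] n = ≡.trans (cong (λ j → 3 + n * 3 + j) (T[3n+2] n)) (exp n (T n))
  where
  exp : ∀ n t → 3 + n * 3 + (n * suc n + (suc n + t)) * 3 ≡ (suc n * suc n + (suc n + t)) * 3
  exp = solve-∀

-- The index 3i + 1 contributes the exponent 1 + 9 T(i), the indices 3i + 2 and 3i + 3 three times
-- the two pentagonal numbers, and the index 0 the leading 1.
triangular-dissection : ∀ n → ∑ (suc (n * 3)) (λ i → X^ T i)
  ≈ dil 3 (𝟙 ∔ ∑ n (λ i → X^ pent⁻ i ∔ X^ pent⁺ i)) ∔ X^ 1 · dil 9 (∑ n (λ i → X^ T i))
triangular-dissection zero = begin
  𝟘 ∔ X^ 0                                  ≈⟨ trans (∔-identityˡ _) X^-zero ⟩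
  𝟙                                         ≈⟨ solve 2 (λ a x → a := (a :+ con 0ℙ) :+ x :* con 0ℙ) refl 𝟙 (X^ 1) ⟩
  (𝟙 ∔ const 0ℙ) ∔ X^ 1 · const 0ℙ          ≈⟨ ∔-cong (trans (∔-cong (sym (dil-𝟙 2)) (sym (trans (dil-∑ 2 0 X^_) 𝟘≈))) (sym (dil-∔ 3 𝟙 𝟘))) (·-congˡ (sym (trans (dil-∑ 8 0 X^_) 𝟘≈))) ⟩
  dil 3 (𝟙 ∔ 𝟘) ∔ X^ 1 · dil 9 𝟘            ∎
  where
  open ≈-Reasoning
  𝟘≈ : 𝟘 ≈ const 0ℙ
  𝟘≈ = mk≈ λ { zero → ≡.refl ; (suc _) → ≡.refl }
triangular-dissection (suc n) = begin
  ∑ (suc (n * 3)) (λ i → X^ T i) ∔ X^ T (suc (n * 3)) ∔ X^ T (2 + n * 3) ∔ X^ T (3 + n * 3)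
    ≈⟨ ∔-cong (∔-cong (∔-cong (triangular-dissection n)
         (trans (X^-cong (T[3n+1] n)) (trans (X^-+ 1 (T n * 9)) (·-congˡ (sym (dil-X^ 8 (T n)))))))
         (trans (X^-cong (T[3n+2] n)) (sym (dil-X^ 2 (pent⁻ n)))))
         (trans (X^-cong (T[3n+3] n)) (sym (dil-X^ 2 (pent⁺ n)))) ⟩
  dil 3 (𝟙 ∔ P) ∔ X^ 1 · dil 9 S ∔ X^ 1 · dil 9 t ∔ dil 3 a ∔ dil 3 b
    ≈⟨ solve 6 (λ p x s t a b → p :+ x :* s :+ x :* t :+ a :+ b := (p :+ (a :+ b)) :+ x :* (s :+ t)) refl
         (dil 3 (𝟙 ∔ P)) (X^ 1) (dil 9 S) (dil 9 t) (dil 3 a) (dil 3 b) ⟩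
  (dil 3 (𝟙 ∔ P) ∔ (dil 3 a ∔ dil 3 b)) ∔ X^ 1 · (dil 9 S ∔ dil 9 t)
    ≈⟨ ∔-cong (trans (∔-congˡ (sym (dil-∔ 3 a b))) (trans (sym (dil-∔ 3 (𝟙 ∔ P) (a ∔ b))) (dil-cong 3 (∔-assoc 𝟙 P (a ∔ b)))))
              (·-congˡ (sym (dil-∔ 9 S t))) ⟩
  dil 3 (𝟙 ∔ (P ∔ (a ∔ b))) ∔ X^ 1 · dil 9 (S ∔ t) ∎
  where
  open ≈-Reasoning
  P S t a b : Ser
  P = ∑ n (λ i → X^ pent⁻ i ∔ X^ pent⁺ i) ; S = ∑ n (λ i → X^ T i)
  t = X^ T n ; a = X^ pent⁻ n ; b = X^ pent⁺ n

-- `e₉` is a repeated substitution so that `dil 3` carries `e₃` to `e₉` by definition.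
e₃ e₉ : Ser
e₃ = dil 3 e
e₉ = dil 3 e₃

ψ-dissection : ψ ≈ e₃ ∔ X^ 1 · dil 9 ψ
ψ-dissection = ≈[]⇒≈ λ N → let open ≈[]-Reasoning N in begin
  ψ ≈⟨ ∑∞≈∑ ψ-summable (m≤n⇒m≤1+n (m≤m*n N 3)) ⟩
  ∑ (suc (N * 3)) (λ i → X^ T i) ≈⟨ ≈⇒≈[] (triangular-dissection N) ⟩
  dil 3 (𝟙 ∔ ∑ N (λ i → X^ pent⁻ i ∔ X^ pent⁺ i)) ∔ X^ 1 · dil 9 (∑ N (λ i → X^ T i))
    ≈⟨ ∔-cong[] (dil-cong[] 3 (sym[] (pentagonal N))) (·-cong[] refl[] (dil-cong[] 9 (sym[] (∑∞≈∑ ψ-summable ≤-refl)))) ⟩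
  e₃ ∔ X^ 1 · dil 9 ψ ∎

e³-dissection : e ↑ 3 ≈ e₃ ∔ X^ 1 · e₉ ↑ 3
e³-dissection = begin
  e ↑ 3                       ≈⟨ e³≈ψ ⟩
  ψ                           ≈⟨ ψ-dissection ⟩
  e₃ ∔ X^ 1 · dil 9 ψ         ≈⟨ ∔-congˡ (·-congˡ (trans (dil-cong 9 (sym e³≈ψ)) (trans (dil-↑ 8 e 3) (↑-congˡ 3 (sym (dil-dil 2 2 e)))))) ⟩
  e₃ ∔ X^ 1 · e₉ ↑ 3          ∎
  where open ≈-Reasoning

cubic : e ↑ 3 · e₃ ↑ 3 ≈ e ↑ 12 ∔ X^ 1 · e₃ ↑ 12
cubic = ∔≈𝟘⇒≈ (≈[]⇒≈ vanish)
  where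
  D : Ser
  D = e ↑ 3 · e₃ ↑ 3 ∔ (e ↑ 12 ∔ X^ 1 · e₃ ↑ 12)
  dil-D : dil 3 D ≈ e₃ ↑ 3 · e₉ ↑ 3 ∔ (e₃ ↑ 12 ∔ X^ 3 · e₉ ↑ 12)
  dil-D = trans (dil-∔ 3 (e ↑ 3 · e₃ ↑ 3) (e ↑ 12 ∔ X^ 1 · e₃ ↑ 12))
    (∔-cong (trans (dil-· 2 (e ↑ 3) (e₃ ↑ 3)) (·-cong (dil-↑ 2 e 3) (dil-↑ 2 e₃ 3)))
            (trans (dil-∔ 3 (e ↑ 12) (X^ 1 · e₃ ↑ 12)) (∔-cong (dil-↑ 2 e 12)
              (trans (dil-· 2 (X^ 1) (e₃ ↑ 12)) (·-cong (dil-X^ 2 1) (dil-↑ 2 e₃ 12))))))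
  D-descends : D ≈ X^ 1 · dil 3 D
  D-descends = begin
    e ↑ 3 · e₃ ↑ 3 ∔ (e ↑ 12 ∔ X^ 1 · e₃ ↑ 12)
      -- Fourth powers are additive modulo 2, so e¹² = (e³)⁴ becomes a⁴ + x⁴ b¹². Its a⁴ cancels
      -- against a · a³, and the three terms left share a factor q.
      ≈⟨ ∔-cong (·-congʳ e³-dissection) (∔-congʳ (trans (solve 1 (λ e → e :^ 12 := (e :^ 3) :^ 4) refl e) (↑-congˡ 4 e³-dissection))) ⟩
    (a ∔ x · b ↑ 3) · a ↑ 3 ∔ ((a ∔ x · b ↑ 3) ↑ 4 ∔ x · a ↑ 12)
      ≈⟨ solve 3 (λ a x b → (a :+ x :* b :^ 3) :* a :^ 3 :+ ((a :+ x :* b :^ 3) :^ 4 :+ x :* a :^ 12)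
                   := x :* (a :^ 3 :* b :^ 3 :+ (a :^ 12 :+ (x :* x :* x) :* b :^ 12))) refl a x b ⟩
    x · (a ↑ 3 · b ↑ 3 ∔ (a ↑ 12 ∔ (x · x · x) · b ↑ 12))
      ≈⟨ ·-congˡ (trans (∔-congˡ (∔-congˡ (·-congʳ (X^·X^·X^ ≡.refl)))) (sym dil-D)) ⟩
    X^ 1 · dil 3 D ∎
    where
    open ≈-Reasoning
    a b x : Ser
    a = e₃ ; b = e₉ ; x = X^ 1
  vanish : ∀ N → D ≈[ N ] 𝟘
  vanish zero    = mk≈[] λ _ ()
  vanish (suc N) = begin
    D                ≈⟨ ≈⇒≈[] D-descends ⟩
    -- The substitution of q³ cannot lower the order of vanishing, so the factor q gains one power.
    X^ 1 · dil 3 D   ≈⟨ X^·-cong[] 1 (dil-cong[] 3 (vanish N)) ⟩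
    X^ 1 · dil 3 𝟘   ≈⟨ ≈⇒≈[] (trans (·-congˡ (dil-∑ 2 0 X^_)) (·-zeroʳ (X^ 1))) ⟩
    𝟘                ∎
    where open ≈[]-Reasoning (suc N)

-- Evaluation of the series 𝒩

∑-triangle : ∀ N (G : ℕ → ℕ → Ser) → ∑ N (λ n → ∑ (suc n) (G n)) ≈ ∑ N (λ s → ∑ (N ∸ s) (λ k → G (s + k) s))
∑-triangle zero    G = refl
∑-triangle (suc N) G = begin
  ∑ N (λ n → ∑ (suc n) (G n)) ∔ ∑ (suc N) (G N)
    ≈⟨ ∔-congʳ (∑-triangle N G) ⟩
  ∑ N (λ s → ∑ (N ∸ s) (λ k → G (s + k) s)) ∔ ∑ (suc N) (G N)
    ≈⟨ ∔-congʳ (sym (trans (∔-congˡ (reflexive (cong (λ M → ∑ M (λ k → G (N + k) N)) (n∸n≡0 N)))) (∔-identityʳ _))) ⟩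
  ∑ (suc N) (λ s → ∑ (N ∸ s) (λ k → G (s + k) s)) ∔ ∑ (suc N) (G N)
    ≈⟨ ∑-∔ (suc N) _ _ ⟨
  ∑ (suc N) (λ s → ∑ (N ∸ s) (λ k → G (s + k) s) ∔ G N s)
    ≈⟨ ∑-cong (suc N) (λ s s<1+N → row s (s≤s⁻¹ s<1+N)) ⟩
  ∑ (suc N) (λ s → ∑ (suc N ∸ s) (λ k → G (s + k) s)) ∎
  where
  open ≈-Reasoning
  row : ∀ s → s ≤ N → ∑ (N ∸ s) (λ k → G (s + k) s) ∔ G N s ≈ ∑ (suc N ∸ s) (λ k → G (s + k) s)
  row s s≤N = trans (∔-congˡ (reflexive (cong (λ M → G M s) (≡.sym (m+[n∸m]≡n s≤N)))))
                    (reflexive (cong (λ M → ∑ M (λ k → G (s + k) s)) (≡.sym (+-∸-assoc 1 s≤N))))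

-- Expand `β n` by `gauss` and put n = s + k. The exponent n(n + 1) + T(s) becomes 3 T(s) + k(k + 2s
-- + 1), so the sum over k is a Durfee sum of offset 2s + 1, equal to `r`, and the sum over s is
-- ψ(q³).
𝒩≈r·e₃³ : 𝒩 ≈ r · e₃ ↑ 3
𝒩≈r·e₃³ = ≈[]⇒≈ λ N → let open ≈[]-Reasoning N in begin
  𝒩 ≈⟨ ∑∞≈∑ 𝒩-summable ≤-refl ⟩
  ∑ N (λ n → X^ (n * suc n) · β n)
    ≈⟨ ≈⇒≈[] (trans (∑-cong N (λ n _ → trans (·-congˡ (sym (gauss n))) (∑-distribˡ (suc n) _ _))) (∑-triangle N _)) ⟩
  ∑ N (λ s → ∑ (N ∸ s) (λ k → X^ ((s + k) * suc (s + k)) · gaussTerm (s + k) s))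
    ≈⟨ ≈⇒≈[] (∑-cong N (λ s _ → trans (∑-cong (N ∸ s) (λ k _ → regroup s k)) (sym (∑-distribˡ (N ∸ s) _ _)))) ⟩
  ∑ N (λ s → X^ (T s * 3) · ∑ (N ∸ s) (rect (suc (2 * s))))
    ≈⟨ ∑-cong[] N (λ s s<N → weaken (enough N s (<⇒≤ s<N)) (X^·-cong[] (T s * 3) (durfee (N ∸ s) (suc (2 * s))))) ⟩
  ∑ N (λ s → X^ (T s * 3) · r)
    ≈⟨ ≈⇒≈[] (trans (∑-cong N (λ s _ → trans (·-comm _ r) (·-congˡ (sym (dil-X^ 2 (T s)))))) (sym (trans (·-congˡ (dil-∑ 2 N _)) (∑-distribˡ N r _)))) ⟩
  r · dil 3 (∑ N (λ s → X^ T s))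
    ≈⟨ ·-cong[] refl[] (dil-cong[] 3 (sym[] (∑∞≈∑ ψ-summable ≤-refl))) ⟩
  r · dil 3 ψ
    ≈⟨ ≈⇒≈[] (·-congˡ (trans (dil-cong 3 (sym e³≈ψ)) (dil-↑ 2 e 3))) ⟩
  r · e₃ ↑ 3 ∎
  where
  -- The inner sum has only `N ∸ s` terms and is known only below q^(N-s); the factor `X^ (T s * 3)`
  -- supplies the rest.
  enough : ∀ N s → s ≤ N → N ≤ T s * 3 + (N ∸ s)
  enough N s s≤N = ≤-trans (≤-reflexive (≡.sym (m+[n∸m]≡n s≤N))) (+-monoˡ-≤ (N ∸ s) (≤-trans (n≤T s) (m≤m*n (T s) 3)))
  regroup : ∀ s k → X^ ((s + k) * suc (s + k)) · gaussTerm (s + k) s ≈ X^ (T s * 3) · rect (suc (2 * s)) k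
  regroup s k = begin
    x · (X^ T s · R (s + k ∸ s) · R (s + k + suc s))
      ≈⟨ ·-congˡ (·-cong (·-congˡ (reflexive (cong R (m+n∸m≡n s k)))) (reflexive (cong R (exp₁ s k)))) ⟩
    x · (X^ T s · R k · R (k + suc (2 * s)))
      ≈⟨ solve 4 (λ x t a b → x :* (t :* a :* b) := x :* t :* a :* b) refl x (X^ T s) (R k) (R (k + suc (2 * s))) ⟩
    x · X^ T s · R k · R (k + suc (2 * s))
      ≈⟨ ·-congʳ (·-congʳ (trans (X^·X^ exp₂) (X^-+ (T s * 3) (k * (k + suc (2 * s)))))) ⟩
    X^ (T s * 3) · X^ (k * (k + suc (2 * s))) · R k · R (k + suc (2 * s))
      ≈⟨ solve 4 (λ x t a b → x :* t :* a :* b := x :* (t :* a :* b)) refl (X^ (T s * 3)) (X^ (k * (k + suc (2 * s)))) (R k) (R (k + suc (2 * s))) ⟩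
    X^ (T s * 3) · rect (suc (2 * s)) k ∎
    where
    open ≈-Reasoning
    x : Ser
    x = X^ ((s + k) * suc (s + k))
    exp₁ : ∀ s k → s + k + suc s ≡ k + suc (2 * s)
    exp₁ = solve-∀
    exp₃ : ∀ s k t → (s + k) * suc (s + k) + t ≡ s * suc s + (k * (k + suc (2 * s)) + t)
    exp₃ = solve-∀
    exp₄ : ∀ t u → t + t + (u + t) ≡ t * 3 + u
    exp₄ = solve-∀
    exp₂ : (s + k) * suc (s + k) + T s ≡ T s * 3 + k * (k + suc (2 * s))
    exp₂ = ≡.trans (exp₃ s k (T s)) (≡.trans (cong (_+ (k * (k + suc (2 * s)) + T s)) (≡.sym (2T≡ s))) (exp₄ (T s) (k * (k + suc (2 * s)))))

∏-split : ∀ m n F → ∏ (m + n) F ≈ ∏ m F · ∏ n (λ i → F (m + i))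
∏-split m zero    F = trans (reflexive (cong (λ k → ∏ k F) (+-identityʳ m))) (sym (·-identityʳ _))
∏-split m (suc n) F = trans (reflexive (cong (λ k → ∏ k F) (+-suc m n))) (trans (·-congʳ (∏-split m n F)) (·-assoc _ _ _))

-- The sixth-order function λ₆

-- (q²ᵐ⁺¹;q²)ₙ
O[_] : ℕ → ℕ → Ser
O[ m ] n = ∏ n (λ i → 𝟙 ∔ X^ suc (2 * (m + i)))

-- The n-th term of Σ qⁿ (z;q²)ₙ / (q)ₙ at z = q²ᵐ⁺¹
λTerm : ℕ → ℕ → Ser
λTerm m n = X^ n · O[ m ] n · R n

-- If L(z) denotes the sum of the terms `λTerm m n` at z = q^(2m+1), this is the closed form of the
-- partial sums of L(z) + qz L(q²z).
λCert : ℕ → ℕ → Ser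
λCert m n = O[ suc m ] n · R n · (𝟙 ∔ X^ (2 * suc m + n))

O[]-head : ∀ m n → O[ m ] (suc n) ≈ (𝟙 ∔ X^ suc (2 * m)) · O[ suc m ] n
O[]-head m n = trans (∏-head n _) (·-cong (∔-congˡ (X^-cong (cong (λ k → suc (2 * k)) (+-identityʳ m))))
  (∏-cong n (λ i → ∔-congˡ (X^-cong (cong (λ k → suc (2 * k)) (+-suc m i))))))

λ-telescope : ∀ m n → ∑ (suc n) (λTerm m) ∔ X^ (2 * suc m) · ∑ (suc n) (λTerm (suc m)) ≈ λCert m n
λ-telescope m zero = begin
  (𝟘 ∔ X^ 0 · 𝟙 · 𝟙) ∔ X^ (2 * suc m) · (𝟘 ∔ X^ 0 · 𝟙 · 𝟙)
    ≈⟨ ∔-cong one (·-cong (X^-cong (≡.sym (+-identityʳ (2 * suc m)))) one) ⟩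
  𝟙 ∔ X^ (2 * suc m + 0) · 𝟙
    ≈⟨ solve 1 (λ x → con 1ℙ :+ x :* con 1ℙ := con 1ℙ :* con 1ℙ :* (con 1ℙ :+ x)) refl (X^ (2 * suc m + 0)) ⟩
  𝟙 · 𝟙 · (𝟙 ∔ X^ (2 * suc m + 0)) ∎
  where
  open ≈-Reasoning
  one : 𝟘 ∔ X^ 0 · 𝟙 · 𝟙 ≈ 𝟙
  one = trans (∔-identityˡ _) (trans (·-identityʳ _) (trans (·-identityʳ _) X^-zero))
λ-telescope m (suc n) = begin
  (s ∔ λTerm m (suc n)) ∔ X^ (2 * suc m) · (s' ∔ λTerm (suc m) (suc n))
    ≈⟨ solve 5 (λ s a x s' b → (s :+ a) :+ x :* (s' :+ b) := (s :+ x :* s') :+ (a :+ x :* b)) refl s (λTerm m (suc n)) (X^ (2 * suc m)) s' (λTerm (suc m) (suc n)) ⟩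
  (s ∔ X^ (2 * suc m) · s') ∔ (λTerm m (suc n) ∔ X^ (2 * suc m) · λTerm (suc m) (suc n))
    ≈⟨ ∔-cong (trans (λ-telescope m n) (·-cong (·-congˡ (R-suc n)) (∔-congˡ (sym (X^·X^ (exp₁ m n))))))
         (∔-cong (·-congʳ (·-congˡ (O[]-head m n))) (·-cong (sym (X^·X^ (exp₂ m))) (·-congʳ (·-congˡ (·-congˡ (∔-congˡ zY²)))))) ⟩
  o · ((𝟙 ∔ Y) · a) · (𝟙 ∔ z · Y) ∔ (Y · ((𝟙 ∔ z) · o) · a ∔ (z · x) · (Y · (o · (𝟙 ∔ z · Y · Y)) · a))
    ≈⟨ solve 5 (λ o Y a z x →
         o :* ((con 1ℙ :+ Y) :* a) :* (con 1ℙ :+ z :* Y)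
           :+ (Y :* ((con 1ℙ :+ z) :* o) :* a :+ (z :* x) :* (Y :* (o :* (con 1ℙ :+ z :* Y :* Y)) :* a))
         := (o :* (con 1ℙ :+ z :* Y :* Y)) :* a :* (con 1ℙ :+ z :* x :* Y)) refl o Y a z x ⟩
  (o · (𝟙 ∔ z · Y · Y)) · a · (𝟙 ∔ z · x · Y)
    ≈⟨ ·-cong (·-congʳ (·-congˡ (∔-congˡ (sym zY²)))) (∔-congˡ (X^·X^·X^ (exp₃ m n))) ⟩
  λCert m (suc n) ∎
  where
  open ≈-Reasoning
  s s' o Y a z x : Ser
  s = ∑ (suc n) (λTerm m) ; s' = ∑ (suc n) (λTerm (suc m))
  o = O[ suc m ] n ; Y = X^ suc n ; a = R (suc n) ; z = X^ suc (2 * m) ; x = X^ 1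
  exp₁ : ∀ m n → suc (2 * m) + suc n ≡ 2 * suc m + n
  exp₁ = solve-∀
  exp₂ : ∀ m → suc (2 * m) + 1 ≡ 2 * suc m
  exp₂ = solve-∀
  exp₃ : ∀ m n → suc (2 * m) + 1 + suc n ≡ 2 * suc m + suc n
  exp₃ = solve-∀
  exp₄ : ∀ m n → suc (2 * m) + suc n + suc n ≡ suc (2 * (suc m + n))
  exp₄ = solve-∀
  zY² : X^ suc (2 * (suc m + n)) ≈ z · Y · Y
  zY² = sym (X^·X^·X^ (exp₄ m n))

-- Only the first m + 1 factors of (q;q²)∞ = r are missing, and their inverse is `β m`.
O[]-limit : ∀ m {n N} → N ≤ n → O[ suc m ] n ≈[ N ] r · β m
O[]-limit m {n} {N} N≤n = begin
  O[ suc m ] n                     ≈⟨ ≈⇒≈[] (·-identityˡ _) ⟨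
  𝟙 · O[ suc m ] n                 ≈⟨ ≈⇒≈[] (·-congʳ (O·β m)) ⟨
  O (suc m) · β m · O[ suc m ] n   ≈⟨ ≈⇒≈[] (solve 3 (λ a b c → a :* b :* c := a :* c :* b) refl (O (suc m)) (β m) (O[ suc m ] n)) ⟩
  O (suc m) · O[ suc m ] n · β m   ≈⟨ ≈⇒≈[] (·-congʳ (sym (∏-split (suc m) n _))) ⟩
  O (suc m + n) · β m              ≈⟨ ·-cong[] (O≈r (≤-trans N≤n (m≤n+m n (suc m)))) refl[] ⟩
  r · β m                          ∎
  where open ≈[]-Reasoning N

λCert-limit : ∀ m N → λCert m N ≈[ N ] r · r · β m
λCert-limit m N = begin
  O[ suc m ] N · R N · (𝟙 ∔ X^ (2 * suc m + N))
    ≈⟨ ·-cong[] (·-cong[] (O[]-limit m ≤-refl) (sym[] (r≈R ≤-refl))) (1+X^≈𝟙 (m≤n+m N (2 * suc m))) ⟩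
  r · β m · r · 𝟙
    ≈⟨ ≈⇒≈[] (solve 2 (λ r b → r :* b :* r :* con 1ℙ := r :* r :* b) refl r (β m)) ⟩
  r · r · β m ∎
  where open ≈[]-Reasoning N

-- The factors qz met at z = q, q³, q⁵, ... are q², q⁴, q⁶, ...; their products q^(m(m+1)) are the
-- weights in `𝒩`.
λ-iterate : ∀ n M → ∑ (suc n) (λTerm 0) ≈ ∑ M (λ m → X^ (m * suc m) · λCert m n) ∔ X^ (M * suc M) · ∑ (suc n) (λTerm M)
λ-iterate n zero    = sym (trans (∔-identityˡ _) (trans (·-congʳ X^-zero) (·-identityˡ _)))
λ-iterate n (suc M) = begin
  ∑ (suc n) (λTerm 0)
    ≈⟨ λ-iterate n M ⟩
  S ∔ X^ (M * suc M) · ∑ (suc n) (λTerm M)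
    ≈⟨ solve 5 (λ s x a y b → s :+ x :* a := (s :+ x :* (a :+ y :* b)) :+ (x :* y) :* b) refl
        S (X^ (M * suc M)) (∑ (suc n) (λTerm M)) (X^ (2 * suc M)) (∑ (suc n) (λTerm (suc M))) ⟩
  (S ∔ X^ (M * suc M) · (∑ (suc n) (λTerm M) ∔ X^ (2 * suc M) · ∑ (suc n) (λTerm (suc M)))) ∔ (X^ (M * suc M) · X^ (2 * suc M)) · ∑ (suc n) (λTerm (suc M))
    ≈⟨ ∔-cong (∔-congˡ (·-congˡ (λ-telescope M n))) (·-congʳ (X^·X^ (exp M))) ⟩
  (S ∔ X^ (M * suc M) · λCert M n) ∔ X^ (suc M * suc (suc M)) · ∑ (suc n) (λTerm (suc M)) ∎
  where
  open ≈-Reasoning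
  S : Ser
  S = ∑ M (λ m → X^ (m * suc m) · λCert m n)
  exp : ∀ M → M * suc M + 2 * suc M ≡ suc M * suc (suc M)
  exp = solve-∀

λTerm-summable : ∀ m n → λTerm m n ≈[ n ] 𝟘
λTerm-summable m n = trans[] (≈⇒≈[] (·-assoc _ _ _)) (X^·≈𝟘 _ ≤-refl)

B : Ser
B = r ↑ 3 · e₃ ↑ 3

∑λ≈B : ∑∞ (λTerm 0) ≈ B
∑λ≈B = ≈[]⇒≈ λ N → let open ≈[]-Reasoning N in begin
  ∑∞ (λTerm 0)                   ≈⟨ ∑∞≈∑ (λTerm-summable 0) (n≤1+n N) ⟩
  ∑ (suc N) (λTerm 0)            ≈⟨ ≈⇒≈[] (λ-iterate N N) ⟩
  ∑ N (λ m → X^ (m * suc m) · λCert m N) ∔ X^ (N * suc N) · ∑ (suc N) (λTerm N)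
    ≈⟨ ∔-cong[] (∑-cong[] N (λ m _ → trans[] (·-cong[] refl[] (λCert-limit m N))
         (≈⇒≈[] (solve 3 (λ x r b → x :* (r :* b) := r :* (x :* b)) refl (X^ (m * suc m)) (r · r) (β m))))) (X^·≈𝟘 _ (m≤m*n N (suc N))) ⟩
  ∑ N (λ m → r · r · (X^ (m * suc m) · β m)) ∔ 𝟘
    ≈⟨ ≈⇒≈[] (trans (∔-identityʳ _) (sym (∑-distribˡ N (r · r) _))) ⟩
  r · r · ∑ N (λ m → X^ (m * suc m) · β m)
    ≈⟨ ·-cong[] refl[] (sym[] (∑∞≈∑ 𝒩-summable ≤-refl)) ⟩
  r · r · 𝒩
    ≈⟨ ≈⇒≈[] (trans (·-congˡ 𝒩≈r·e₃³) (solve 2 (λ r a → r :* r :* (r :* a) := r :^ 3 :* a) refl r (e₃ ↑ 3))) ⟩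
  B ∎

-- The sixth-order function ψ₆

-- The n-th terms of Σ q^(n²+n) zⁿ / (q)ₙ² and Σ q^(n²+n) zⁿ / ((q)ₙ² (1 - z q²ⁿ)) at z = q²ᵐ⁺¹
πTerm σTerm : ℕ → ℕ → Ser
πTerm m n = X^ (n * (n + 2 * suc m)) · (R n · R n)
σTerm m n = πTerm m n · geo (suc (2 * (m + n)))

π∞ σ∞ : ℕ → Ser
π∞ m = ∑∞ (πTerm m)
σ∞ m = ∑∞ (σTerm m)

πTerm-summable : ∀ m n → πTerm m n ≈[ n ] 𝟘
πTerm-summable m n = X^·≈𝟘 _ (n≤n*[n+m] n (2 * suc m))

σTerm-summable : ∀ m n → σTerm m n ≈[ n ] 𝟘
σTerm-summable m n = trans[] (≈⇒≈[] (·-assoc _ _ _)) (X^·≈𝟘 _ (n≤n*[n+m] n (2 * suc m)))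

πTerm-zero : ∀ m → πTerm m 0 ≈ 𝟙
πTerm-zero m = trans (·-cong X^-zero (·-identityʳ 𝟙)) (·-identityʳ 𝟙)

-- Modulo 2 the factor is (1 + q^(k+1))², which strips one factor from each copy of (q)ₖ₊₁. What
-- remains is the term of index k at q²z, times zq² = q^(2m+3).
πTerm-suc : ∀ m k → (𝟙 ∔ X^ suc k · X^ suc k) · πTerm m (suc k) ≈ X^ suc (2 * suc m) · πTerm (suc m) k
πTerm-suc m k = begin
  (𝟙 ∔ Y · Y) · (X^ (suc k * (suc k + 2 * suc m)) · (a · a))
    ≈⟨ solve 3 (λ Y x a → (con 1ℙ :+ Y :* Y) :* (x :* (a :* a)) := x :* (((con 1ℙ :+ Y) :* a) :* ((con 1ℙ :+ Y) :* a))) refl Y (X^ (suc k * (suc k + 2 * suc m))) a ⟩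
  X^ (suc k * (suc k + 2 * suc m)) · (((𝟙 ∔ Y) · a) · ((𝟙 ∔ Y) · a))
    ≈⟨ ·-cong (trans (X^-cong (exp m k)) (X^-+ (suc (2 * suc m)) (k * (k + 2 * suc (suc m))))) (·-cong (sym (R-suc k)) (sym (R-suc k))) ⟩
  X^ suc (2 * suc m) · X^ (k * (k + 2 * suc (suc m))) · (R k · R k)
    ≈⟨ ·-assoc _ _ _ ⟩
  X^ suc (2 * suc m) · πTerm (suc m) k ∎
  where
  open ≈-Reasoning
  Y a : Ser
  Y = X^ suc k ; a = R (suc k)
  exp : ∀ m k → suc k * (suc k + 2 * suc m) ≡ suc (2 * suc m) + k * (k + 2 * suc (suc m))
  exp = solve-∀

πTerm-shift : ∀ m n → πTerm (suc m) n ≈ X^ n · X^ n · πTerm m n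
πTerm-shift m n = trans (·-congʳ (sym (X^·X^·X^ (exp m n)))) (·-assoc _ _ _)
  where
  exp : ∀ m n → n + n + n * (n + 2 * suc m) ≡ n * (n + 2 * suc (suc m))
  exp = solve-∀

π-sum : ∀ m N → ∑ (suc N) (πTerm m) ≈ ∑ (suc N) (πTerm (suc m)) ∔ X^ suc (2 * suc m) · ∑ N (πTerm (suc m))
π-sum m N = begin
  ∑ (suc N) (πTerm m)
    ≈⟨ ∑-head N (πTerm m) ⟩
  πTerm m 0 ∔ ∑ N (λ k → πTerm m (suc k))
    ≈⟨ ∔-cong (trans (πTerm-zero m) (sym (πTerm-zero (suc m)))) (∑-cong N (λ k _ → split k)) ⟩
  πTerm (suc m) 0 ∔ ∑ N (λ k → πTerm (suc m) (suc k) ∔ X^ suc (2 * suc m) · πTerm (suc m) k)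
    ≈⟨ trans (∔-congˡ (∑-∔ N _ _)) (sym (∔-assoc _ _ _)) ⟩
  (πTerm (suc m) 0 ∔ ∑ N (λ k → πTerm (suc m) (suc k))) ∔ ∑ N (λ k → X^ suc (2 * suc m) · πTerm (suc m) k)
    ≈⟨ ∔-cong (sym (∑-head N _)) (sym (∑-distribˡ N _ _)) ⟩
  ∑ (suc N) (πTerm (suc m)) ∔ X^ suc (2 * suc m) · ∑ N (πTerm (suc m)) ∎
  where
  open ≈-Reasoning
  split : ∀ k → πTerm m (suc k) ≈ πTerm (suc m) (suc k) ∔ X^ suc (2 * suc m) · πTerm (suc m) k
  split k = trans (solve 2 (λ y p → p := y :* p :+ (con 1ℙ :+ y) :* p) refl (X^ suc k · X^ suc k) (πTerm m (suc k)))
    (∔-cong (sym (πTerm-shift m (suc k))) (πTerm-suc m k))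

-- Modulo 2, (q)ₙ² is (q²;q²)ₙ, so `π∞` is Euler's expansion of (zq²;q²)∞, and this is the
-- functional equation of that product.
π∞-suc : ∀ m → π∞ m ≈ (𝟙 ∔ X^ suc (2 * suc m)) · π∞ (suc m)
π∞-suc m = ≈[]⇒≈ λ N → let open ≈[]-Reasoning N in begin
  π∞ m ≈⟨ ∑∞≈∑ (πTerm-summable m) (n≤1+n N) ⟩
  ∑ (suc N) (πTerm m) ≈⟨ ≈⇒≈[] (π-sum m N) ⟩
  ∑ (suc N) (πTerm (suc m)) ∔ X^ suc (2 * suc m) · ∑ N (πTerm (suc m))
    ≈⟨ ∔-cong[] (sym[] (∑∞≈∑ (πTerm-summable (suc m)) (n≤1+n N))) (·-cong[] refl[] (sym[] (∑∞≈∑ (πTerm-summable (suc m)) ≤-refl))) ⟩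
  π∞ (suc m) ∔ X^ suc (2 * suc m) · π∞ (suc m)
    ≈⟨ ≈⇒≈[] (solve 2 (λ x p → p :+ x :* p := (con 1ℙ :+ x) :* p) refl (X^ suc (2 * suc m)) (π∞ (suc m))) ⟩
  (𝟙 ∔ X^ suc (2 * suc m)) · π∞ (suc m) ∎

π∞≈𝟙 : ∀ m → π∞ m ≈[ m ] 𝟙
π∞≈𝟙 m = begin
  π∞ m ≈⟨ ∑∞≈∑ (πTerm-summable m) (n≤1+n m) ⟩
  ∑ (suc m) (πTerm m) ≈⟨ ≈⇒≈[] (∑-head m (πTerm m)) ⟩
  πTerm m 0 ∔ ∑ m (λ k → πTerm m (suc k)) ≈⟨ ∔-cong[] (≈⇒≈[] (πTerm-zero m)) (small m) ⟩
  𝟙 ∔ 𝟘 ≈⟨ ≈⇒≈[] (∔-identityʳ 𝟙) ⟩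
  𝟙 ∎
  where
  open ≈[]-Reasoning m
  large : ∀ k → m ≤ suc k * (suc k + 2 * suc m)
  large k = ≤-trans (n≤1+n m) (≤-trans (m≤n*m (suc m) 2) (≤-trans (m≤n+m (2 * suc m) (suc k)) (m≤n*m (suc k + 2 * suc m) (suc k))))
  small : ∀ M → ∑ M (λ k → πTerm m (suc k)) ≈[ m ] 𝟘
  small zero    = refl[]
  small (suc M) = trans[] (∔-cong[] (small M) (X^·≈𝟘 _ (large M))) (≈⇒≈[] (∔-identityʳ 𝟘))

-- `π∞-suc` makes the left side independent of m, and for large m the factor `O` tends to `r` and
-- `π∞` to 1.
O·π∞ : ∀ m → O (suc m) · π∞ m ≈ r
O·π∞ m = ≈[]⇒≈ λ N → let open ≈[]-Reasoning N in begin
  O (suc m) · π∞ m             ≈⟨ ≈⇒≈[] (constant N) ⟩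
  O (suc (N + m)) · π∞ (N + m) ≈⟨ ·-cong[] (O≈r (≤-trans (m≤m+n N m) (n≤1+n (N + m)))) (weaken (m≤m+n N m) (π∞≈𝟙 (N + m))) ⟩
  r · 𝟙                        ≈⟨ ≈⇒≈[] (·-identityʳ r) ⟩
  r ∎
  where
  constant : ∀ k → O (suc m) · π∞ m ≈ O (suc (k + m)) · π∞ (k + m)
  constant zero    = refl
  constant (suc k) = trans (constant k) (trans (·-congˡ (π∞-suc (k + m))) (sym (·-assoc _ _ _)))

π∞≈r·β : ∀ m → π∞ m ≈ r · β m
π∞≈r·β m = begin
  π∞ m                       ≈⟨ trans (sym (·-identityˡ _)) (·-congʳ (sym (O·β m))) ⟩
  O (suc m) · β m · π∞ m     ≈⟨ solve 3 (λ a b c → a :* b :* c := a :* c :* b) refl (O (suc m)) (β m) (π∞ m) ⟩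
  O (suc m) · π∞ m · β m     ≈⟨ ·-congʳ (O·π∞ m) ⟩
  r · β m ∎
  where open ≈-Reasoning

-- Write 1 + z as (1 + zy) + z(1 + y) with y = q^(2k+2). On the term of index k + 1 the first part
-- cancels the denominator, and the second lowers the index by `πTerm-suc`. The weight z · zq² is
-- q^(4m+4).
σ-sum : ∀ m N → (𝟙 ∔ X^ suc (2 * m)) · ∑ (suc N) (σTerm m) ≈ ∑ (suc N) (πTerm m) ∔ X^ (2 * (2 * suc m)) · ∑ N (σTerm (suc m))
σ-sum m N = begin
  (𝟙 ∔ z) · ∑ (suc N) (σTerm m)
    ≈⟨ trans (·-congˡ (∑-head N (σTerm m))) (·-distribˡ-∔ _ _ _) ⟩
  (𝟙 ∔ z) · σTerm m 0 ∔ (𝟙 ∔ z) · ∑ N (λ k → σTerm m (suc k))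
    ≈⟨ ∔-cong first (trans (∑-distribˡ N _ _) (∑-cong N (λ k _ → rest k))) ⟩
  πTerm m 0 ∔ ∑ N (λ k → πTerm m (suc k) ∔ X^ (2 * (2 * suc m)) · σTerm (suc m) k)
    ≈⟨ trans (∔-congˡ (∑-∔ N _ _)) (sym (∔-assoc _ _ _)) ⟩
  (πTerm m 0 ∔ ∑ N (λ k → πTerm m (suc k))) ∔ ∑ N (λ k → X^ (2 * (2 * suc m)) · σTerm (suc m) k)
    ≈⟨ ∔-cong (sym (∑-head N _)) (sym (∑-distribˡ N _ _)) ⟩
  ∑ (suc N) (πTerm m) ∔ X^ (2 * (2 * suc m)) · ∑ N (σTerm (suc m)) ∎
  where
  open ≈-Reasoning
  z : Ser
  z = X^ suc (2 * m)
  first : (𝟙 ∔ z) · σTerm m 0 ≈ πTerm m 0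
  first = trans (·-congʳ (∔-congˡ (X^-cong (cong (λ k → suc (2 * k)) (≡.sym (+-identityʳ m)))))) (geo-cancel (2 * (m + 0)) (πTerm m 0))
  rest : ∀ k → (𝟙 ∔ z) · σTerm m (suc k) ≈ πTerm m (suc k) ∔ X^ (2 * (2 * suc m)) · σTerm (suc m) k
  rest k = begin
    (𝟙 ∔ z) · (t · g)
      ≈⟨ solve 4 (λ z y t g → (con 1ℙ :+ z) :* (t :* g) := (con 1ℙ :+ z :* y) :* (t :* g) :+ z :* ((con 1ℙ :+ y) :* t) :* g) refl z (Y · Y) t g ⟩
    (𝟙 ∔ z · (Y · Y)) · (t · g) ∔ z · ((𝟙 ∔ Y · Y) · t) · g
      ≈⟨ ∔-cong (trans (·-congʳ (∔-congˡ (trans (sym (·-assoc _ _ _)) (X^·X^·X^ (exp₁ m k))))) (geo-cancel (2 * (m + suc k)) t))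
                (·-cong (·-congˡ (πTerm-suc m k)) (reflexive (cong (λ j → geo (suc (2 * j))) (+-suc m k)))) ⟩
    t ∔ z · (X^ suc (2 * suc m) · πTerm (suc m) k) · geo (suc (2 * (suc m + k)))
      ≈⟨ ∔-congˡ (trans (solve 4 (λ z x t g → z :* (x :* t) :* g := (z :* x) :* (t :* g)) refl z (X^ suc (2 * suc m)) (πTerm (suc m) k) (geo (suc (2 * (suc m + k)))))
           (·-congʳ (X^·X^ (exp₂ m)))) ⟩
    t ∔ X^ (2 * (2 * suc m)) · σTerm (suc m) k ∎
    where
    t g Y : Ser
    t = πTerm m (suc k) ; g = geo (suc (2 * (m + suc k))) ; Y = X^ suc k
    exp₁ : ∀ m k → suc (2 * m) + suc k + suc k ≡ suc (2 * (m + suc k))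
    exp₁ = solve-∀
    exp₂ : ∀ m → suc (2 * m) + suc (2 * suc m) ≡ 2 * (2 * suc m)
    exp₂ = solve-∀

σ∞-suc : ∀ m → (𝟙 ∔ X^ suc (2 * m)) · σ∞ m ≈ r · β m ∔ X^ (2 * (2 * suc m)) · σ∞ (suc m)
σ∞-suc m = ≈[]⇒≈ λ N → let open ≈[]-Reasoning N in begin
  (𝟙 ∔ X^ suc (2 * m)) · σ∞ m ≈⟨ ·-cong[] refl[] (∑∞≈∑ (σTerm-summable m) (n≤1+n N)) ⟩
  (𝟙 ∔ X^ suc (2 * m)) · ∑ (suc N) (σTerm m) ≈⟨ ≈⇒≈[] (σ-sum m N) ⟩
  ∑ (suc N) (πTerm m) ∔ X^ (2 * (2 * suc m)) · ∑ N (σTerm (suc m))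
    ≈⟨ ∔-cong[] (sym[] (∑∞≈∑ (πTerm-summable m) (n≤1+n N))) (·-cong[] refl[] (sym[] (∑∞≈∑ (σTerm-summable (suc m)) ≤-refl))) ⟩
  π∞ m ∔ X^ (2 * (2 * suc m)) · σ∞ (suc m)
    ≈⟨ ≈⇒≈[] (∔-congʳ (π∞≈r·β m)) ⟩
  r · β m ∔ X^ (2 * (2 * suc m)) · σ∞ (suc m) ∎

-- The weights multiply to q^(4 + 8 + ... + 4m), the square of the weight in `𝒩`. One factor `β m`
-- comes from dividing by the successive 1 + z, the other from `π∞≈r·β`, so the summands are squares
-- of those of `𝒩`.
σ-iterate : ∀ M → σ∞ 0 ≈ r · ∑ M (λ m → (X^ (m * suc m) · β m) · (X^ (m * suc m) · β m))
                        ∔ X^ (2 * (M * suc M)) · ∏ M (λ i → geo (suc (2 * i))) · σ∞ M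
σ-iterate zero    = sym (trans (∔-cong (·-zeroʳ r) (trans (·-congʳ (trans (·-identityʳ _) X^-zero)) (·-identityˡ _))) (∔-identityˡ _))
σ-iterate (suc M) = begin
  σ∞ 0 ≈⟨ σ-iterate M ⟩
  r · S ∔ X^ (2 * (M * suc M)) · b · σ∞ M
    ≈⟨ ∔-congˡ (·-congˡ (sym (geo-cancel (2 * M) (σ∞ M)))) ⟩
  r · S ∔ X^ (2 * (M * suc M)) · b · ((𝟙 ∔ X^ suc (2 * M)) · (σ∞ M · g))
    ≈⟨ ∔-congˡ (solve 5 (λ x b a s g → x :* b :* (a :* (s :* g)) := x :* (b :* g) :* (a :* s)) refl (X^ (2 * (M * suc M))) b (𝟙 ∔ X^ suc (2 * M)) (σ∞ M) g) ⟩
  r · S ∔ X^ (2 * (M * suc M)) · β M · ((𝟙 ∔ X^ suc (2 * M)) · σ∞ M)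
    ≈⟨ ∔-congˡ (·-cong (·-congʳ (X^-square (M * suc M))) (σ∞-suc M)) ⟩
  r · S ∔ (x · x) · β M · (r · β M ∔ X^ (2 * (2 * suc M)) · σ∞ (suc M))
    ≈⟨ solve 6 (λ r s x b y t → r :* s :+ (x :* x) :* b :* (r :* b :+ y :* t) := r :* (s :+ (x :* b) :* (x :* b)) :+ (x :* x :* y) :* b :* t) refl
         r S x (β M) (X^ (2 * (2 * suc M))) (σ∞ (suc M)) ⟩
  r · (S ∔ (x · β M) · (x · β M)) ∔ (x · x · X^ (2 * (2 * suc M))) · β M · σ∞ (suc M)
    ≈⟨ ∔-congˡ (·-congʳ (·-congʳ (X^·X^·X^ (exp M)))) ⟩
  r · (S ∔ (x · β M) · (x · β M)) ∔ X^ (2 * (suc M * suc (suc M))) · β M · σ∞ (suc M) ∎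
  where
  open ≈-Reasoning
  S b g x : Ser
  S = ∑ M (λ m → (X^ (m * suc m) · β m) · (X^ (m * suc m) · β m))
  b = ∏ M (λ i → geo (suc (2 * i))) ; g = geo (suc (2 * M)) ; x = X^ (M * suc M)
  exp : ∀ M → M * suc M + M * suc M + 2 * (2 * suc M) ≡ 2 * (suc M * suc (suc M))
  exp = solve-∀

C : Ser
C = r ↑ 3 · e₃ ↑ 6

σ∞≈C : σ∞ 0 ≈ C
σ∞≈C = ≈[]⇒≈ λ N → let open ≈[]-Reasoning N in begin
  σ∞ 0 ≈⟨ ≈⇒≈[] (σ-iterate N) ⟩
  r · ∑ N (λ m → (X^ (m * suc m) · β m) · (X^ (m * suc m) · β m)) ∔ X^ (2 * (N * suc N)) · ∏ N (λ i → geo (suc (2 * i))) · σ∞ N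
    ≈⟨ ∔-cong[] (≈⇒≈[] (·-congˡ (sym (∑-square N _)))) (trans[] (≈⇒≈[] (·-assoc _ _ _)) (X^·≈𝟘 _ (≤-trans (m≤m*n N (suc N)) (m≤n*m (N * suc N) 2)))) ⟩
  r · (∑ N (λ m → X^ (m * suc m) · β m) · ∑ N (λ m → X^ (m * suc m) · β m)) ∔ 𝟘
    ≈⟨ trans[] (≈⇒≈[] (∔-identityʳ _)) (·-cong[] refl[] (·-cong[] (sym[] (∑∞≈∑ 𝒩-summable ≤-refl)) (sym[] (∑∞≈∑ 𝒩-summable ≤-refl)))) ⟩
  r · (𝒩 · 𝒩)
    ≈⟨ ≈⇒≈[] (trans (·-congˡ (·-cong 𝒩≈r·e₃³ 𝒩≈r·e₃³)) (solve 2 (λ r a → r :* ((r :* a :^ 3) :* (r :* a :^ 3)) := r :^ 3 :* a :^ 6) refl r e₃)) ⟩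
  C ∎

-- The sixth-order function 2μ₆ and the third-order functions

-- `Q-double` solved for (q;q²)ₙ / (q)₂ₙ, the quotient hidden in the terms of both φ₆ and ψ₆.
O·R-double : ∀ n → O n · R (2 * n) ≈ R n · R n
O·R-double n = begin
  O n · R (2 * n)
    ≈⟨ trans (sym (·-identityʳ _)) (·-congˡ (sym (trans (·-cong (Q·R n) (Q·R n)) (·-identityʳ 𝟙)))) ⟩
  O n · R (2 * n) · ((Q n · R n) · (Q n · R n))
    ≈⟨ solve 4 (λ o a q s → o :* a :* ((q :* s) :* (q :* s)) := (o :* (q :* q)) :* a :* (s :* s)) refl (O n) (R (2 * n)) (Q n) (R n) ⟩
  O n · (Q n · Q n) · R (2 * n) · (R n · R n)
    ≈⟨ ·-congʳ (trans (·-congʳ (sym (Q-double n))) (Q·R (2 * n))) ⟩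
  𝟙 · (R n · R n) ≈⟨ ·-identityˡ _ ⟩
  R n · R n ∎
  where open ≈-Reasoning

μTerm : ℕ → Ser
μTerm n = X^ suc n · (𝟙 ∔ X^ n) · O n · R (suc n)

-- The terms are the successive differences of `O n · R n`, since (1 + q^(n+1)) + q^(n+1) (1 + q^n)
-- = 1 + q^(2n+1); the leading 1 is the value at n = 0.
μ-telescope : ∀ N → 𝟙 ∔ ∑ N μTerm ≈ O N · R N
μ-telescope zero    = trans (∔-identityʳ 𝟙) (sym (·-identityʳ 𝟙))
μ-telescope (suc n) = begin
  𝟙 ∔ (∑ n μTerm ∔ μTerm n)                      ≈⟨ trans (sym (∔-assoc _ _ _)) (∔-congʳ (trans (μ-telescope n) (·-congˡ (R-suc n)))) ⟩
  O n · ((𝟙 ∔ x) · a) ∔ x · (𝟙 ∔ y) · O n · a   ≈⟨ solve 4 (λ o x y a → o :* ((con 1ℙ :+ x) :* a) :+ x :* (con 1ℙ :+ y) :* o :* a := o :* (con 1ℙ :+ x :* y) :* a) refl (O n) x y a ⟩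
  O n · (𝟙 ∔ x · y) · a                          ≈⟨ ·-congʳ (·-congˡ (∔-congˡ (X^·X^ (exp n)))) ⟩
  O n · (𝟙 ∔ X^ suc (2 * n)) · a                 ∎
  where
  open ≈-Reasoning
  x y a : Ser
  x = X^ suc n ; y = X^ n ; a = R (suc n)
  exp : ∀ n → suc n + n ≡ suc (2 * n)
  exp = solve-∀

μTerm-summable : ∀ i → μTerm i ≈[ i ] 𝟘
μTerm-summable i = trans[] (≈⇒≈[] (trans (·-assoc _ _ _) (·-assoc _ _ _))) (X^·≈𝟘 _ (n≤1+n i))

∑μ≈r² : 𝟙 ∔ ∑∞ μTerm ≈ r · r
∑μ≈r² = ≈[]⇒≈ λ N → trans[] (∔-cong[] refl[] (∑∞≈∑ μTerm-summable ≤-refl))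
  (trans[] (≈⇒≈[] (μ-telescope N)) (·-cong[] (O≈r ≤-refl) (sym[] (r≈R ≤-refl))))

∑rect≈r : ∑∞ (rect 0) ≈ r
∑rect≈r = ≈[]⇒≈ λ N → trans[] (∑∞≈∑ rect-summable ≤-refl) (durfee N 0)
  where
  rect-summable : ∀ i → rect 0 i ≈[ i ] 𝟘
  rect-summable i = trans[] (≈⇒≈[] (·-assoc _ _ _)) (X^·≈𝟘 _ (n≤n*[n+m] i 0))

-- Reduction modulo 2

par : ℤ → Parity
par i = parity ∣ i ∣

parity-suc : ∀ n → parity (suc n) ≡ parity n ℙ.⁻¹
parity-suc n = ≡.trans (≡.sym (ℙ.⁻¹-selfInverse ≡.refl)) (cong ℙ._⁻¹ (ℙ.suc-homo-⁻¹ n))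

par-⊖ : ∀ m n → par (m ⊖ n) ≡ parity m ℙ.+ parity n
par-⊖ m       zero    = ≡.sym (ℙ.+-identityʳ (parity m))
par-⊖ zero    (suc n) = ≡.refl
par-⊖ (suc m) (suc n) = ≡.trans (cong par (ℤ.[1+m]⊖[1+n]≡m⊖n m n)) (≡.trans (par-⊖ m n)
  (≡.trans (h (parity m) (parity n)) (≡.sym (cong₂ ℙ._+_ (parity-suc m) (parity-suc n)))))
  where
  h : ∀ a b → a ℙ.+ b ≡ (a ℙ.⁻¹) ℙ.+ (b ℙ.⁻¹)
  h 0ℙ 0ℙ = ≡.refl
  h 0ℙ 1ℙ = ≡.refl
  h 1ℙ 0ℙ = ≡.refl
  h 1ℙ 1ℙ = ≡.refl

par-+ : ∀ i j → par (i ℤ.+ j) ≡ par i ℙ.+ par j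
par-+ (+ m)    (+ n)    = ℙ.+-homo-+ m n
par-+ (+ m)    -[1+ n ] = par-⊖ m (suc n)
par-+ -[1+ m ] (+ n)    = ≡.trans (par-⊖ n (suc m)) (ℙ.+-comm (parity n) (parity (suc m)))
par-+ -[1+ m ] -[1+ n ] = ≡.trans (cong parity (≡.sym (+-suc (suc m) n))) (ℙ.+-homo-+ (suc m) (suc n))

par-* : ∀ i j → par (i ℤ.* j) ≡ par i ℙ.* par j
par-* i j = ≡.trans (cong parity (ℤ.abs-* i j)) (ℙ.*-homo-* ∣ i ∣ ∣ j ∣)

par-- : ∀ i j → par (i ℤ.- j) ≡ par i ℙ.+ par j
par-- i j = ≡.trans (par-+ i (ℤ.- j)) (cong (λ k → par i ℙ.+ parity k) (ℤ.∣-i∣≡∣i∣ j))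

par-^ : ∀ a n → par a ≡ 1ℙ → par (a ℤ.^ n) ≡ 1ℙ
par-^ a zero    odd = ≡.refl
par-^ a (suc n) odd = ≡.trans (par-* a (a ℤ.^ n)) (cong₂ ℙ._*_ odd (par-^ a n odd))

even⇒2∣ : ∀ n → parity n ≡ 0ℙ → 2 ℕ.∣ n
even⇒2∣ zero          _ = 2 ℕ.∣0
even⇒2∣ (suc (suc n)) p = ℕ.∣m∣n⇒∣m+n ℕ.∣-refl (even⇒2∣ n p)

≡₂-from : ∀ a b {x} → par a ≡ x → par b ≡ x → a ≡₂ b
≡₂-from a b {x} p q = even⇒2∣ ∣ a ℤ.- b ∣ (≡.trans (par-- a b) (≡.trans (cong₂ ℙ._+_ p q) (ℙ.p+p≡0ℙ x)))

≡₂⇒par : ∀ a b → a ≡₂ b → par a ≡ par b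
≡₂⇒par a b (ℕ.divides k eq) = h (par a) (par b) (≡.trans (≡.sym (par-- a b)) (≡.trans (cong parity eq)
  (≡.trans (ℙ.*-homo-* k 2) (ℙ.*-zeroʳ (parity k)))))
  where
  h : ∀ x y → x ℙ.+ y ≡ 0ℙ → x ≡ y
  h 0ℙ y p  = ≡.sym p
  h 1ℙ 1ℙ _ = ≡.refl

red : Series → Ser
red f n = par (f n)

sumTo-head : ∀ n F → sumTo (suc n) F ≡ F 0 ℤ.+ sumTo n (F ∘ suc)
sumTo-head zero    F = ≡.refl
sumTo-head (suc n) F = ≡.trans (cong (ℤ._+ F (suc (suc n))) (sumTo-head n F)) (ℤ.+-assoc (F 0) _ _)

red-⊕ : ∀ f g → red (f ⊕ g) ≈ red f ∔ red g
red-⊕ f g = mk≈ λ n → ≡.trans (par-+ (f n) (g n)) (≡.sym (∔-at (red f) (red g) n))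

red-⊛ : ∀ f g → red (f ⊛ g) ≈ red f · red g
red-⊛ f g = mk≈ λ n → h n f
  where
  h : ∀ n f → par (sumTo n (λ i → f i ℤ.* g (n ∸ i))) ≡ (red f · red g) n
  h zero    f = ≡.trans (par-* (f 0) (g 0)) (≡.sym (·-at-zero (red f) (red g)))
  h (suc n) f = ≡.trans (cong par (sumTo-head n (λ i → f i ℤ.* g (suc n ∸ i))))
    (≡.trans (par-+ (f 0 ℤ.* g (suc n)) _)
    (≡.trans (cong₂ ℙ._+_ (par-* (f 0) (g (suc n))) (h n (f ∘ suc))) (≡.sym (·-at-suc (red f) (red g) n))))

infix 4 _↝_

-- A record, so that f can be inferred from a proof of f ↝ F.
record _↝_ (f : Series) (F : Ser) : Set where
  constructor mk↝
  field reduces : red f ≈ F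
open _↝_

↝-⊛ : ∀ {f g F G} → f ↝ F → g ↝ G → f ⊛ g ↝ F · G
↝-⊛ {f} {g} (mk↝ p) (mk↝ q) = mk↝ (trans (red-⊛ f g) (·-cong p q))

↝-≈ : ∀ {f F G} → f ↝ F → F ≈ G → f ↝ G
↝-≈ (mk↝ p) q = mk↝ (trans p q)

X^-at : ∀ k n → (X^ k) n ≡ (if n ≡ᵇ k then 1ℙ else 0ℙ)
X^-at zero    zero    = at X^-zero 0
X^-at zero    (suc n) = at X^-zero (suc n)
X^-at (suc k) zero    = X^-suc-at-zero k
X^-at (suc k) (suc n) = ≡.trans (at (tail-X^-suc k) n) (X^-at k n)

red-qpow : ∀ k → qpow k ↝ X^ k
red-qpow k = mk↝ (mk≈ λ n → ≡.trans (Bool.if-float par (n ≡ᵇ k)) (≡.sym (X^-at k n)))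

red-oneS : red oneS ≈ 𝟙
red-oneS = trans (reduces (red-qpow 0)) X^-zero

red-^ˢ : ∀ f n → red (f ^ˢ n) ≈ red f ↑ n
red-^ˢ f zero    = red-oneS
red-^ˢ f (suc n) = trans (red-⊛ f (f ^ˢ n)) (·-congˡ (red-^ˢ f n))

↝-^ˢ : ∀ f {F} n → f ↝ F → f ^ˢ n ↝ F ↑ n
↝-^ˢ f n (mk↝ p) = mk↝ (trans (red-^ˢ f n) (↑-congˡ n p))

↝-sign : ∀ {f F} k → f ↝ F → scale (sign k) f ↝ F
↝-sign {f} k (mk↝ p) = mk↝ (trans (mk≈ λ n → ≡.trans (par-* (sign k) (f n)) (cong (ℙ._* par (f n)) (par-^ -1ℤ k ≡.refl))) p)

red-oneMinus : ∀ a k → par a ≡ 1ℙ → oneMinus a k ↝ 𝟙 ∔ X^ k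
red-oneMinus a k odd = mk↝ (mk≈ λ n → ≡.trans (par-- (δ n 0) (a ℤ.* δ n k))
  (≡.trans (cong₂ ℙ._+_ (at red-oneS n) (≡.trans (par-* a (δ n k)) (cong₂ ℙ._*_ odd (at (reduces (red-qpow k)) n)))) (≡.sym (∔-at 𝟙 (X^ k) n))))

red-geomInv : ∀ a k → par a ≡ 1ℙ → geomInv a (suc k) ↝ geo (suc k)
red-geomInv a k odd = mk↝ (mk≈ λ n → ≡.trans (Bool.if-float par (n % suc k ≡ᵇ 0))
  (cong (λ x → if n % suc k ≡ᵇ 0 then x else 0ℙ) (par-^ a (n / suc k) odd)))

red-prodS : ∀ {F G} n → (∀ i → F i ↝ G i) → prodS (map F (upTo n)) ↝ ∏ n G
red-prodS {F} {G} n p = mk↝ (h n id)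
  where
  -- The tail of `upTo (suc n)` is an `applyUpTo`, so the induction carries a reindexing `g`.
  h : ∀ n (g : ℕ → ℕ) → red (prodS (map F (applyUpTo g n))) ≈ ∏ n (G ∘ g)
  h zero    g = red-oneS
  h (suc n) g = trans (red-⊛ (F (g 0)) (prodS (map F (applyUpTo (g ∘ suc) n))))
    (trans (·-cong (reduces (p (g 0))) (h n (g ∘ suc))) (sym (∏-head n (G ∘ g))))

red-sumS : ∀ {F G} → (∀ i → F i ↝ G i) → sumS F ↝ ∑∞ G
red-sumS {F} {G} p = mk↝ (mk≈ λ m → h m m)
  where
  h : ∀ n m → par (sumTo n (λ i → F i m)) ≡ ∑ (suc n) G m
  h zero    m = ≡.trans (at (reduces (p 0)) m) (≡.sym (at (∔-identityˡ (G 0)) m))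
  h (suc n) m = ≡.trans (par-+ (sumTo n (λ i → F i m)) (F (suc n) m))
    (≡.trans (cong₂ ℙ._+_ (h n m) (at (reduces (p (suc n))) m)) (≡.sym (∔-at (∑ (suc n) G) (G (suc n)) m)))

red-R : ∀ a n → par a ≡ 1ℙ → qPochInv a 1 1 n ↝ R n
red-R a n odd = red-prodS n (λ i → ↝-≈ (red-geomInv a (1 * i) odd) (reflexive (cong (λ k → geo (suc k)) (*-identityˡ i))))

red-O : ∀ n → qPoch 1ℤ 1 2 n ↝ O n
red-O n = red-prodS n (λ i → red-oneMinus 1ℤ (1 + 2 * i) ≡.refl)

geo-square : ∀ k → geo (suc k) · geo (suc k) ≈ geo (suc k * 2)
geo-square k = trans (frobenius (geo (suc k))) (dil-dil 1 k ones)

red-R² : ∀ n → qPochInv -1ℤ 2 2 n ↝ R n · R n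
red-R² n = ↝-≈ (red-prodS n (λ i → ↝-≈ (red-geomInv -1ℤ (1 + 2 * i) ≡.refl)
  (trans (reflexive (cong (λ k → geo (suc k)) (cong suc (*-comm 2 i)))) (sym (geo-square i))))) (sym (∏-square n _))

-- `E k m` has m factors and is read at q^m, one power beyond the reach of `e≈Q`; the next factor 1
-- + q^(m+1) is still invisible there.
Q≈e : ∀ m → Q m ≈[ suc m ] e
Q≈e m = sym[] (trans[] (e≈Q ≤-refl) (trans[] (·-cong[] refl[] (1+X^≈𝟙 ≤-refl)) (≈⇒≈[] (·-identityʳ (Q m)))))

R≈r : ∀ m → R m ≈[ suc m ] r
R≈r m = sym[] (trans[] (r≈R ≤-refl) (trans[] (·-cong[] refl[] (geo≈𝟙 ≤-refl)) (≈⇒≈[] (·-identityʳ (R m)))))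

red-E : ∀ k → E (suc k) ↝ dil (suc k) e
red-E k = mk↝ (mk≈ λ m → ≡.trans (at (reduces (factors m)) m) (below (dil-cong[] (suc k) (Q≈e m)) m ≤-refl))
  where
  factors : ∀ m → qPoch 1ℤ (suc k) (suc k) m ↝ dil (suc k) (Q m)
  factors m = ↝-≈ (red-prodS m (λ i → ↝-≈ (red-oneMinus 1ℤ (suc k + suc k * i) ≡.refl)
    (trans (∔-cong (sym (dil-𝟙 k)) (trans (X^-cong (cong (λ j → suc k + j) (*-comm (suc k) i))) (sym (dil-X^ k (suc i)))))
           (sym (dil-∔ (suc k) 𝟙 (X^ suc i)))))) (sym (dil-∏ k m _))

red-Einv : ∀ k → Einv (suc k) ↝ dil (suc k) r
red-Einv k = mk↝ (mk≈ λ m → ≡.trans (at (reduces (factors m)) m) (below (dil-cong[] (suc k) (R≈r m)) m ≤-refl))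
  where
  factors : ∀ m → qPochInv 1ℤ (suc k) (suc k) m ↝ dil (suc k) (R m)
  factors m = ↝-≈ (red-prodS m (λ i → ↝-≈ (red-geomInv 1ℤ (k + suc k * i) ≡.refl)
    (trans (reflexive (cong (λ j → geo (suc (k + j))) (*-comm (suc k) i))) (sym (dil-dil k i ones))))) (sym (dil-∏ k m _))

-- Partitions

X^·-at : ∀ k f n → (X^ k · f) n ≡ (if k ≤ᵇ n then f (n ∸ k) else 0ℙ)
X^·-at k f n with k ≤ᵇ n | ≤ᵇ-reflects-≤ k n
... | Bool.false | ofⁿ k≰n = X^·-at-< k f n (≰⇒> k≰n)
... | Bool.true  | ofʸ k≤n with m , ≡.refl ← m≤n⇒∃[o]m+o≡n k≤n = ≡.trans (X^·-at-+ k f m) (cong f (≡.sym (m+n∸m≡n k m)))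

-- Multiplied by 1 + q^(k+1) the sum telescopes to `f`. The index j will be the multiplicity of the
-- part k + 1.
∑-geometric : ∀ k f → ∑∞ (λ j → X^ (j * suc k) · f) ≈ f · geo (suc k)
∑-geometric k f = begin
  S                                       ≈⟨ geo-cancel k S ⟨
  (𝟙 ∔ X^ suc k) · (S · geo (suc k))      ≈⟨ ·-assoc _ _ _ ⟨
  (𝟙 ∔ X^ suc k) · S · geo (suc k)        ≈⟨ ·-congʳ (≈[]⇒≈ h) ⟩
  f · geo (suc k)                         ∎
  where
  open ≈-Reasoning
  S : Ser
  S = ∑∞ (λ j → X^ (j * suc k) · f)
  telescope : ∀ N → (𝟙 ∔ X^ suc k) · ∑ N (λ j → X^ (j * suc k) · f) ≈ f ∔ X^ (N * suc k) · f
  telescope zero    = trans (·-zeroʳ _) (sym (trans (∔-congˡ (trans (·-congʳ X^-zero) (·-identityˡ f))) (f∔f≈𝟘 f)))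
  telescope (suc N) = trans (·-distribˡ-∔ _ _ _) (trans (∔-congʳ (telescope N))
    (trans (solve 3 (λ f x y → (f :+ y :* f) :+ (con 1ℙ :+ x) :* (y :* f) := f :+ (x :* y) :* f) refl f (X^ suc k) (X^ (N * suc k)))
           (∔-congˡ (·-congʳ (sym (X^-+ (suc k) (N * suc k)))))))
  h : ∀ N → (𝟙 ∔ X^ suc k) · S ≈[ N ] f
  h N = trans[] (·-cong[] refl[] (∑∞≈∑ (λ i → X^·≈𝟘 f (m≤m*n i (suc k))) ≤-refl))
    (trans[] (≈⇒≈[] (telescope N)) (trans[] (∔-cong[] refl[] (X^·≈𝟘 f (m≤m*n N (suc k)))) (≈⇒≈[] (∔-identityʳ f))))

-- Allowing one more part size multiplies the generating function by one factor `geo (suc k)`. The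
-- range j ≤ n in `partsLe` is the truncation built into `∑∞`.
parity-partsLe : ∀ k n → parity (partsLe n k) ≡ R k n
parity-partsLe zero    zero    = ≡.refl
parity-partsLe zero    (suc n) = ≡.refl
parity-partsLe (suc k) n = ≡.trans (sums (suc n) id) (at (∑-geometric k (R k)) n)
  where
  count : ℕ → ℕ
  count j = if j * suc k ≤ᵇ n then partsLe (n ∸ j * suc k) k else 0
  parity-count : ∀ j → parity (count j) ≡ (X^ (j * suc k) · R k) n
  parity-count j = ≡.trans (Bool.if-float parity (j * suc k ≤ᵇ n)) (≡.trans
    (cong (λ x → if j * suc k ≤ᵇ n then x else 0ℙ) (parity-partsLe k (n ∸ j * suc k))) (≡.sym (X^·-at (j * suc k) (R k) n)))
  sums : ∀ m (g : ℕ → ℕ) → parity (sum (map count (applyUpTo g m))) ≡ ∑ m (λ i → X^ (g i * suc k) · R k) n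
  sums zero    g = ≡.refl
  sums (suc m) g = ≡.trans (ℙ.+-homo-+ (count (g 0)) (sum (map count (applyUpTo (g ∘ suc) m))))
    (≡.trans (cong₂ ℙ._+_ (parity-count (g 0)) (sums m (g ∘ suc)))
    (≡.trans (≡.sym (∔-at (X^ (g 0 * suc k) · R k) _ n)) (≡.sym (at (∑-head m (λ i → X^ (g i * suc k) · R k)) n))))

parity-p : ∀ n → parity (p n) ≡ r n
parity-p n = ≡.trans (parity-partsLe n n) (below (R≈r n) n ≤-refl)

-- The mock theta functions modulo 2

red-f₃ : f₃ ↝ r
red-f₃ = ↝-≈ (red-sumS term) ∑rect≈r
  where
  term : ∀ n → qpow (n * n) ⊛ (qPochInv -1ℤ 1 1 n) ^ˢ 2 ↝ rect 0 n
  term n = ↝-≈ (↝-⊛ (red-qpow (n * n)) (↝-^ˢ (qPochInv -1ℤ 1 1 n) 2 (red-R -1ℤ n ≡.refl)))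
    (trans (solve 2 (λ x a → x :* a :^ 2 := x :* a :* a) refl (X^ (n * n)) (R n))
           (reflexive (cong (λ k → X^ (n * k) · R n · R k) (≡.sym (+-identityʳ n)))))

red-φ₃ : φ₃ ↝ r
red-φ₃ = ↝-≈ (red-sumS term) ∑rect≈r
  where
  term : ∀ n → qpow (n * n) ⊛ qPochInv -1ℤ 2 2 n ↝ rect 0 n
  term n = ↝-≈ (↝-⊛ (red-qpow (n * n)) (red-R² n))
    (trans (sym (·-assoc _ _ _)) (reflexive (cong (λ k → X^ (n * k) · R n · R k) (≡.sym (+-identityʳ n)))))

red-φ₆ : φ₆ ↝ r
red-φ₆ = ↝-≈ (red-sumS term) ∑rect≈r
  where
  simplify : ∀ n → O n · X^ (n * n) · R (2 * n) ≈ rect 0 n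
  simplify n = begin
    O n · X^ (n * n) · R (2 * n)
      ≈⟨ solve 3 (λ o x a → o :* x :* a := x :* (o :* a)) refl (O n) (X^ (n * n)) (R (2 * n)) ⟩
    X^ (n * n) · (O n · R (2 * n))
      ≈⟨ trans (·-congˡ (O·R-double n)) (sym (·-assoc _ _ _)) ⟩
    X^ (n * n) · R n · R n
      ≈⟨ reflexive (cong (λ k → X^ (n * k) · R n · R k) (≡.sym (+-identityʳ n))) ⟩
    rect 0 n ∎
    where open ≈-Reasoning
  term : ∀ n → scale (sign n) (qPoch 1ℤ 1 2 n ⊛ qpow (n * n) ⊛ qPochInv -1ℤ 1 1 (2 * n)) ↝ rect 0 n
  term n = ↝-≈ (↝-sign n (↝-⊛ (↝-⊛ (red-O n) (red-qpow (n * n))) (red-R -1ℤ (2 * n) ≡.refl))) (simplify n)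

red-twoμ₆ : twoμ₆ ↝ r · r
red-twoμ₆ = mk↝ (trans (red-⊕ oneS (sumS _)) (trans (∔-cong red-oneS (reduces (red-sumS term))) ∑μ≈r²))
  where
  term : ∀ n → scale (sign n) (qpow (suc n) ⊛ oneMinus -1ℤ n ⊛ qPoch 1ℤ 1 2 n ⊛ qPochInv -1ℤ 1 1 (suc n)) ↝ μTerm n
  term n = ↝-sign n (↝-⊛ (↝-⊛ (↝-⊛ (red-qpow (suc n)) (red-oneMinus -1ℤ n ≡.refl)) (red-O n)) (red-R -1ℤ (suc n) ≡.refl))

red-λ₆ : λ₆ ↝ B
red-λ₆ = ↝-≈ (red-sumS term) ∑λ≈B
  where
  term : ∀ n → scale (sign n) (qpow n ⊛ qPoch 1ℤ 1 2 n ⊛ qPochInv -1ℤ 1 1 n) ↝ λTerm 0 n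
  term n = ↝-sign n (↝-⊛ (↝-⊛ (red-qpow n) (red-O n)) (red-R -1ℤ n ≡.refl))

red-ψ₆ : ψ₆ ↝ X^ 1 · C
red-ψ₆ = ↝-≈ (red-sumS term) (≈[]⇒≈ λ N → trans[] (∑∞≈∑ summable ≤-refl)
    (trans[] (≈⇒≈[] (sym (∑-distribˡ N (X^ 1) (σTerm 0)))) (·-cong[] refl[]
      (trans[] (sym[] (∑∞≈∑ (σTerm-summable 0) ≤-refl)) (≈⇒≈[] σ∞≈C)))))
  where
  summable : ∀ i → X^ 1 · σTerm 0 i ≈[ i ] 𝟘
  summable i = trans[] (·-cong[] refl[] (σTerm-summable 0 i)) (≈⇒≈[] (·-zeroʳ (X^ 1)))
  exp : ∀ n → 1 + n * (n + 2 * 1) ≡ suc n * suc n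
  exp = solve-∀
  simplify : ∀ n → X^ (suc n * suc n) · O n · R (suc (2 * n)) ≈ X^ 1 · σTerm 0 n
  simplify n = begin
    X^ (suc n * suc n) · O n · (R (2 * n) · geo (suc (2 * n)))
      ≈⟨ solve 4 (λ x o a g → x :* o :* (a :* g) := x :* (o :* a) :* g) refl (X^ (suc n * suc n)) (O n) (R (2 * n)) (geo (suc (2 * n))) ⟩
    X^ (suc n * suc n) · (O n · R (2 * n)) · geo (suc (2 * n))
      ≈⟨ ·-congʳ (·-cong (trans (X^-cong (≡.sym (exp n))) (X^-+ 1 (n * (n + 2 * 1)))) (O·R-double n)) ⟩
    X^ 1 · X^ (n * (n + 2 * 1)) · (R n · R n) · geo (suc (2 * n))
      ≈⟨ solve 4 (λ x y a g → x :* y :* a :* g := x :* ((y :* a) :* g)) refl (X^ 1) (X^ (n * (n + 2 * 1))) (R n · R n) (geo (suc (2 * n))) ⟩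
    X^ 1 · σTerm 0 n ∎
    where open ≈-Reasoning
  term : ∀ n → scale (sign n) (qpow (suc n * suc n) ⊛ qPoch 1ℤ 1 2 n ⊛ qPochInv -1ℤ 1 1 (suc (2 * n))) ↝ X^ 1 · σTerm 0 n
  term n = ↝-≈ (↝-sign n (↝-⊛ (↝-⊛ (red-qpow (suc n * suc n)) (red-O n)) (red-R -1ℤ (suc (2 * n)) ≡.refl))) (simplify n)

-- The coefficients of j₃

r₃ A : Ser
r₃ = dil 3 r
A = e ↑ 3 · r₃ ↑ 3

e₃·r₃ : e₃ · r₃ ≈ 𝟙
e₃·r₃ = trans (sym (dil-· 2 e r)) (trans (dil-cong 3 e·r) (dil-𝟙 2))

dil-1 : ∀ f → dil 1 f ≈ f
dil-1 f = mk≈ λ n → dil-at 1 f {n} (n%1≡0 n) (n/1≡n n)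

square-dil : ∀ k f → dil (suc k * 2) f ≈ dil (suc k) f · dil (suc k) f
square-dil k f = trans (sym (dil-dil 1 k f)) (sym (frobenius (dil (suc k) f)))

fourth-dil : ∀ k f → dil (suc k * 2 * 2) f ≈ dil (suc k) f ↑ 4
fourth-dil k f = trans (square-dil (suc (k * 2)) f) (trans (·-cong (square-dil k f) (square-dil k f))
  (solve 1 (λ x → (x :* x) :* (x :* x) := x :^ 4) refl (dil (suc k) f)))

red-c₃ : E 1 ^ˢ 12 ⊛ Einv 3 ^ˢ 12 ↝ (A · A) · (A · A)
red-c₃ = ↝-≈ (↝-⊛ {E 1 ^ˢ 12} {Einv 3 ^ˢ 12} (↝-^ˢ (E 1) 12 (↝-≈ (red-E 0) (dil-1 e))) (↝-^ˢ (Einv 3) 12 (red-Einv 2)))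
  (solve 2 (λ e s → e :^ 12 :* s :^ 12 := ((e :^ 3 :* s :^ 3) :* (e :^ 3 :* s :^ 3)) :* ((e :^ 3 :* s :^ 3) :* (e :^ 3 :* s :^ 3))) refl e r₃)

𝟙↑ : ∀ {f} n → f ≈ 𝟙 → f ↑ n ≈ 𝟙
𝟙↑ zero    _ = refl
𝟙↑ (suc n) p = trans (·-cong p (𝟙↑ n p)) (·-identityʳ 𝟙)

-- Frobenius turns the product into e¹⁶ e₃⁴ r⁴ r₃¹⁶, which cancels down to e¹² r₃¹², the reduction
-- of q j₃.
red-c₁₂ : E 4 ^ˢ 4 ⊛ E 6 ^ˢ 2 ⊛ Einv 2 ^ˢ 2 ⊛ Einv 12 ^ˢ 4 ↝ (A · A) · (A · A)
red-c₁₂ = ↝-≈ (↝-⊛ {E 4 ^ˢ 4 ⊛ E 6 ^ˢ 2 ⊛ Einv 2 ^ˢ 2} {Einv 12 ^ˢ 4} (↝-⊛ {E 4 ^ˢ 4 ⊛ E 6 ^ˢ 2} {Einv 2 ^ˢ 2} (↝-⊛ {E 4 ^ˢ 4} {E 6 ^ˢ 2}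
    (↝-^ˢ (E 4) 4 (↝-≈ (red-E 3) (trans (fourth-dil 0 e) (↑-congˡ 4 (dil-1 e)))))
    (↝-^ˢ (E 6) 2 (↝-≈ (red-E 5) (square-dil 2 e))))
    (↝-^ˢ (Einv 2) 2 (↝-≈ (red-Einv 1) (trans (square-dil 0 r) (·-cong (dil-1 r) (dil-1 r))))))
    (↝-^ˢ (Einv 12) 4 (↝-≈ (red-Einv 11) (fourth-dil 2 r)))) (begin
  (e ↑ 4) ↑ 4 · (e₃ · e₃) ↑ 2 · (r · r) ↑ 2 · (r₃ ↑ 4) ↑ 4
    ≈⟨ solve 4 (λ e s f t → (e :^ 4) :^ 4 :* (f :* f) :^ 2 :* (s :* s) :^ 2 :* (t :^ 4) :^ 4
          := (e :* s) :^ 4 :* (f :* t) :^ 4 :* (((e :^ 3 :* t :^ 3) :* (e :^ 3 :* t :^ 3)) :* ((e :^ 3 :* t :^ 3) :* (e :^ 3 :* t :^ 3)))) refl e r e₃ r₃ ⟩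
  (e · r) ↑ 4 · (e₃ · r₃) ↑ 4 · ((A · A) · (A · A))
    ≈⟨ trans (·-congʳ (trans (·-cong (𝟙↑ 4 e·r) (𝟙↑ 4 e₃·r₃)) (·-identityʳ 𝟙))) (·-identityˡ _) ⟩
  (A · A) · (A · A) ∎)
  where open ≈-Reasoning

-- Cancellation leaves e³ e₃³ r₃¹², and `cubic` rewrites it as e¹² r₃¹² + q. The extra q alters only
-- the constant term of j₆.
red-c₆ : E 2 ^ˢ 3 ⊛ E 3 ^ˢ 9 ⊛ Einv 1 ^ˢ 3 ⊛ Einv 6 ^ˢ 9 ↝ (A · A) · (A · A) ∔ X^ 1
red-c₆ = ↝-≈ (↝-⊛ {E 2 ^ˢ 3 ⊛ E 3 ^ˢ 9 ⊛ Einv 1 ^ˢ 3} {Einv 6 ^ˢ 9} (↝-⊛ {E 2 ^ˢ 3 ⊛ E 3 ^ˢ 9} {Einv 1 ^ˢ 3} (↝-⊛ {E 2 ^ˢ 3} {E 3 ^ˢ 9}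
    (↝-^ˢ (E 2) 3 (↝-≈ (red-E 1) (trans (square-dil 0 e) (·-cong (dil-1 e) (dil-1 e)))))
    (↝-^ˢ (E 3) 9 (red-E 2)))
    (↝-^ˢ (Einv 1) 3 (↝-≈ (red-Einv 0) (dil-1 r))))
    (↝-^ˢ (Einv 6) 9 (↝-≈ (red-Einv 5) (square-dil 2 r)))) (begin
  (e · e) ↑ 3 · e₃ ↑ 9 · r ↑ 3 · (r₃ · r₃) ↑ 9
    ≈⟨ solve 4 (λ e s f t → (e :* e) :^ 3 :* f :^ 9 :* s :^ 3 :* (t :* t) :^ 9
         := (e :* s) :^ 3 :* (f :* t) :^ 6 :* (e :^ 3 :* f :^ 3 :* t :^ 12)) refl e r e₃ r₃ ⟩
  (e · r) ↑ 3 · (e₃ · r₃) ↑ 6 · (e ↑ 3 · e₃ ↑ 3 · r₃ ↑ 12)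
    ≈⟨ trans (·-cong (trans (·-cong (𝟙↑ 3 e·r) (𝟙↑ 6 e₃·r₃)) (·-identityʳ 𝟙)) (·-congʳ cubic)) (·-identityˡ _) ⟩
  (e ↑ 12 ∔ X^ 1 · e₃ ↑ 12) · r₃ ↑ 12
    ≈⟨ solve 4 (λ e x f t → (e :^ 12 :+ x :* f :^ 12) :* t :^ 12
         := ((e :^ 3 :* t :^ 3) :* (e :^ 3 :* t :^ 3)) :* ((e :^ 3 :* t :^ 3) :* (e :^ 3 :* t :^ 3)) :+ x :* (f :* t) :^ 12) refl e (X^ 1) e₃ r₃ ⟩
  (A · A) · (A · A) ∔ X^ 1 · (e₃ · r₃) ↑ 12
    ≈⟨ ∔-congˡ (trans (·-congˡ (𝟙↑ 12 e₃·r₃)) (·-identityʳ _)) ⟩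
  (A · A) · (A · A) ∔ X^ 1 ∎)
  where open ≈-Reasoning

A-dissection : A ≈ dil 3 (r · r) ∔ X^ 1 · dil 3 B
A-dissection = begin
  e ↑ 3 · r₃ ↑ 3
    ≈⟨ ·-congʳ e³-dissection ⟩
  (e₃ ∔ X^ 1 · e₉ ↑ 3) · r₃ ↑ 3
    ≈⟨ solve 4 (λ f x g t → (f :+ x :* g :^ 3) :* t :^ 3 := (f :* t) :* (t :* t) :+ x :* (t :^ 3 :* g :^ 3)) refl e₃ (X^ 1) e₉ r₃ ⟩
  (e₃ · r₃) · (r₃ · r₃) ∔ X^ 1 · (r₃ ↑ 3 · e₉ ↑ 3)
    ≈⟨ ∔-cong (trans (trans (·-congʳ e₃·r₃) (·-identityˡ _)) (sym (dil-· 2 r r)))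
              (·-congˡ (sym (trans (dil-· 2 (r ↑ 3) (e₃ ↑ 3)) (·-cong (dil-↑ 2 r 3) (dil-↑ 2 e₃ 3))))) ⟩
  dil 3 (r · r) ∔ X^ 1 · dil 3 B ∎
  where open ≈-Reasoning

-- Multiplying by (e r)³ exposes e³ e₃³, to which `cubic` applies; both resulting terms, e¹² r⁶ and
-- e₃¹² r⁶, are squares.
B-dissection : B ≈ (e ↑ 3 · e ↑ 3) ∔ X^ 1 · (C · C)
B-dissection = begin
  r ↑ 3 · e₃ ↑ 3
    ≈⟨ sym (trans (·-congʳ (𝟙↑ 3 e·r)) (·-identityˡ _)) ⟩
  (e · r) ↑ 3 · (r ↑ 3 · e₃ ↑ 3)
    ≈⟨ solve 3 (λ e s f → (e :* s) :^ 3 :* (s :^ 3 :* f :^ 3) := (e :^ 3 :* f :^ 3) :* s :^ 6) refl e r e₃ ⟩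
  (e ↑ 3 · e₃ ↑ 3) · r ↑ 6
    ≈⟨ ·-congʳ cubic ⟩
  (e ↑ 12 ∔ X^ 1 · e₃ ↑ 12) · r ↑ 6
    ≈⟨ solve 4 (λ e s f x → (e :^ 12 :+ x :* f :^ 12) :* s :^ 6
         := (e :* s) :^ 6 :* (e :^ 3 :* e :^ 3) :+ x :* ((s :^ 3 :* f :^ 6) :* (s :^ 3 :* f :^ 6))) refl e r e₃ (X^ 1) ⟩
  (e · r) ↑ 6 · (e ↑ 3 · e ↑ 3) ∔ X^ 1 · (C · C)
    ≈⟨ ∔-congʳ (trans (·-congʳ (𝟙↑ 6 e·r)) (·-identityˡ _)) ⟩
  e ↑ 3 · e ↑ 3 ∔ X^ 1 · (C · C) ∎
  where open ≈-Reasoning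

X·-at-suc : ∀ f n → (X^ 1 · f) (suc n) ≡ f n
X·-at-suc f n = X^·-at-+ 1 f n

X·-at-zero : ∀ f → (X^ 1 · f) 0 ≡ 0ℙ
X·-at-zero f = X^·-at-< 1 f 0 (s≤s z≤n)

A-at : ∀ n → A n ≡ dil 3 (r · r) n ℙ.+ (X^ 1 · dil 3 B) n
A-at n = ≡.trans (at A-dissection n) (∔-at (dil 3 (r · r)) (X^ 1 · dil 3 B) n)

A-at-3n : ∀ n → A (n * 3) ≡ (r · r) n
A-at-3n n = ≡.trans (A-at (n * 3)) (≡.trans (cong₂ ℙ._+_ (dil-at-* 3 (r · r) n) (h n)) (ℙ.+-identityʳ _))
  where
  h : ∀ n → (X^ 1 · dil 3 B) (n * 3) ≡ 0ℙ
  h zero    = X·-at-zero (dil 3 B)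
  h (suc n) = ≡.trans (X·-at-suc (dil 3 B) (2 + n * 3)) (dil-at-off 3 B n 1 (s≤s (s≤s (s≤s z≤n))))

A-at-3n+1 : ∀ n → A (1 + n * 3) ≡ B n
A-at-3n+1 n = ≡.trans (A-at (1 + n * 3)) (cong₂ ℙ._+_ (dil-at-off 3 (r · r) n 0 (s≤s (s≤s z≤n)))
  (≡.trans (X·-at-suc (dil 3 B) (n * 3)) (dil-at-* 3 B n)))

A-at-3n+2 : ∀ n → A (2 + n * 3) ≡ 0ℙ
A-at-3n+2 n = ≡.trans (A-at (2 + n * 3)) (cong₂ ℙ._+_ (dil-at-off 3 (r · r) n 1 (s≤s (s≤s (s≤s z≤n))))
  (≡.trans (X·-at-suc (dil 3 B) (1 + n * 3)) (dil-at-off 3 B n 0 (s≤s (s≤s z≤n)))))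

B-at : ∀ n → B n ≡ (e ↑ 3 · e ↑ 3) n ℙ.+ (X^ 1 · (C · C)) n
B-at n = ≡.trans (at B-dissection n) (∔-at (e ↑ 3 · e ↑ 3) (X^ 1 · (C · C)) n)

B-at-even : ∀ n → B (n * 2) ≡ ψ n
B-at-even n = ≡.trans (B-at (n * 2)) (≡.trans (cong₂ ℙ._+_ (≡.trans (square-at-even (e ↑ 3) n) (at e³≈ψ n)) (h n)) (ℙ.+-identityʳ _))
  where
  h : ∀ n → (X^ 1 · (C · C)) (n * 2) ≡ 0ℙ
  h zero    = X·-at-zero (C · C)
  h (suc n) = ≡.trans (X·-at-suc (C · C) (1 + n * 2)) (square-at-odd C n)

B-at-odd : ∀ n → B (1 + n * 2) ≡ C n
B-at-odd n = ≡.trans (B-at (1 + n * 2)) (cong₂ ℙ._+_ (square-at-odd (e ↑ 3) n)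
  (≡.trans (X·-at-suc (C · C) (n * 2)) (square-at-even C n)))

par-c₃ : ∀ n → par (c₃ n) ≡ ((A · A) · (A · A)) (suc n)
par-c₃ n = at (reduces red-c₃) (suc n)

-- j₃ starts at q⁻¹, so its index n is the index n + 1 of A⁴ = A(q⁴).
c₃-at-4m : ∀ n m → suc n ≡ m * 2 * 2 → par (c₃ n) ≡ A m
c₃-at-4m n m eq = ≡.trans (par-c₃ n) (≡.trans (cong ((A · A) · (A · A)) eq)
  (≡.trans (square-at-even (A · A) (m * 2)) (square-at-even A m)))

-- The odd coefficients of ψ

T-mono-< : ∀ {i j} → i < j → T i < T j
T-mono-< {i} {suc j} (s≤s i≤j) with m≤n⇒m<n∨m≡n i≤j
... | inj₁ i<j    = <-≤-trans (T-mono-< i<j) (m≤n+m (T j) (suc j))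
... | inj₂ ≡.refl = m<n+m (T j) (s≤s z≤n)

X^-at-≡ : ∀ k → (X^ k) k ≡ 1ℙ
X^-at-≡ k = ≡.trans (X^-at k k) (cong (λ b → if b then 1ℙ else 0ℙ) (≡ᵇ-refl k))
  where
  ≡ᵇ-refl : ∀ k → (k ≡ᵇ k) ≡ Bool.true
  ≡ᵇ-refl zero    = ≡.refl
  ≡ᵇ-refl (suc k) = ≡ᵇ-refl k

X^-at-≢ : ∀ k n → n ≢ k → (X^ k) n ≡ 0ℙ
X^-at-≢ zero    zero    ≢ = contradiction ≡.refl ≢
X^-at-≢ zero    (suc n) ≢ = X^-at 0 (suc n)
X^-at-≢ (suc k) zero    ≢ = X^-at (suc k) 0
X^-at-≢ (suc k) (suc n) ≢ = ≡.trans (at (tail-X^-suc k) n) (X^-at-≢ k n (≢ ∘ cong suc))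

-- `T` is strictly increasing, so exactly one term has the exponent T(k) and nothing cancels modulo
-- 2.
ψ-at-T : ∀ k → ψ (T k) ≡ 1ℙ
-- The cut is chosen beyond the exponent T(k) and in the shape j + (k + 1) on which `after` inducts.
ψ-at-T k = ≡.trans (below (∑∞≈∑ {M = suc (T k) + suc k} ψ-summable (m≤m+n (suc (T k)) (suc k))) (T k) ≤-refl) (after (suc (T k)))
  where
  before : ∀ m → m ≤ k → ∑ m (λ i → X^ T i) (T k) ≡ 0ℙ
  before zero    _   = ≡.refl
  before (suc m) m<k = ≡.trans (∔-at (∑ m (λ i → X^ T i)) (X^ T m) (T k))
    (cong₂ ℙ._+_ (before m (<⇒≤ m<k)) (X^-at-≢ (T m) (T k) (<⇒≢ (T-mono-< m<k) ∘ ≡.sym)))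
  after : ∀ j → ∑ (j + suc k) (λ i → X^ T i) (T k) ≡ 1ℙ
  after zero    = ≡.trans (∔-at (∑ k (λ i → X^ T i)) (X^ T k) (T k)) (cong₂ ℙ._+_ (before k ≤-refl) (X^-at-≡ (T k)))
  after (suc j) = ≡.trans (∔-at (∑ (j + suc k) (λ i → X^ T i)) (X^ T (j + suc k)) (T k))
    (cong₂ ℙ._+_ (after j) (X^-at-≢ (T (j + suc k)) (T k) (<⇒≢ (T-mono-< (m≤n+m (suc k) j)))))

ψ-support : ∀ n → ψ n ≡ 1ℙ → ∃ λ k → n ≡ T k
ψ-support n = search (suc n)
  where
  search : ∀ m → ∑ m (λ i → X^ T i) n ≡ 1ℙ → ∃ λ k → n ≡ T k
  search (suc m) eq with n ≟ T m
  ... | yes n≡T = m , n≡T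
  ... | no  n≢T = search m (≡.trans (≡.sym (≡.trans (cong₂ ℙ._+_ {x = ∑ m (λ i → X^ T i) n} ≡.refl (X^-at-≢ (T m) n n≢T)) (ℙ.+-identityʳ _)))
                    (≡.trans (≡.sym (∔-at (∑ m (λ i → X^ T i)) (X^ T m) n)) eq))

T≡k[k+1]/2 : ∀ k → T k ≡ (k * (k + 1)) / 2
T≡k[k+1]/2 k = ≡.sym (≡.trans (cong (_/ 2) (≡.trans (cong (k *_) (+-comm k 1)) (≡.trans (≡.sym (2T≡ k)) (exp (T k))))) (m*n/n≡m (T k) 2))
  where
  exp : ∀ t → t + t ≡ t * 2
  exp = solve-∀

-- Parities in the residue classes modulo 24

r²-at-even : ∀ n → (r · r) (2 * n) ≡ r n
r²-at-even n = ≡.trans (cong (r · r) (*-comm 2 n)) (square-at-even r n)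

c₃-24n-1 : ∀ n → 1 ≤ n → par (c₃ (24 * n ∸ 1)) ≡ r n
c₃-24n-1 (suc n) _ = ≡.trans (c₃-at-4m (24 * suc n ∸ 1) (suc n * 2 * 3) (exp n)) (≡.trans (A-at-3n (suc n * 2)) (square-at-even r (suc n)))
  where
  exp : ∀ n → 24 * suc n ≡ suc n * 2 * 3 * 2 * 2
  exp = solve-∀

par-c₆ : ∀ n → 1 ≤ n → par (c₆ n) ≡ ((A · A) · (A · A)) (suc n)
par-c₆ n 1≤n = ≡.trans (at (reduces red-c₆) (suc n)) (≡.trans (∔-at ((A · A) · (A · A)) (X^ 1) (suc n))
  (≡.trans (cong (((A · A) · (A · A)) (suc n) ℙ.+_) (X^-at-≢ 1 (suc n) (<⇒≢ (s≤s 1≤n) ∘ ≡.sym))) (ℙ.+-identityʳ _)))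

par-c₁₂ : ∀ n → par (c₁₂ n) ≡ ((A · A) · (A · A)) (suc n)
par-c₁₂ n = at (reduces red-c₁₂) (suc n)

c₃-2n : ∀ n → par (c₃ (2 * n)) ≡ 0ℙ
c₃-2n n = ≡.trans (par-c₃ (2 * n)) (≡.trans (cong (λ k → ((A · A) · (A · A)) (suc k)) (*-comm 2 n)) (square-at-odd (A · A) n))

c₃-4n+1 : ∀ n → par (c₃ (4 * n + 1)) ≡ 0ℙ
c₃-4n+1 n = ≡.trans (par-c₃ (4 * n + 1)) (≡.trans (cong ((A · A) · (A · A)) (exp n))
  (≡.trans (square-at-even (A · A) (suc (n * 2))) (square-at-odd A n)))
  where
  exp : ∀ n → suc (4 * n + 1) ≡ suc (n * 2) * 2
  exp = solve-∀

c₃-12n+7 : ∀ n → par (c₃ (12 * n + 7)) ≡ 0ℙ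
c₃-12n+7 n = ≡.trans (c₃-at-4m (12 * n + 7) (2 + n * 3) (exp n)) (A-at-3n+2 n)
  where
  exp : ∀ n → suc (12 * n + 7) ≡ (2 + n * 3) * 2 * 2
  exp = solve-∀

c₃-24n+11 : ∀ n → par (c₃ (24 * n + 11)) ≡ 0ℙ
c₃-24n+11 n = ≡.trans (c₃-at-4m (24 * n + 11) (suc (n * 2) * 3) (exp n)) (≡.trans (A-at-3n (suc (n * 2))) (square-at-odd r n))
  where
  exp : ∀ n → suc (24 * n + 11) ≡ suc (n * 2) * 3 * 2 * 2
  exp = solve-∀

c₃-24n+3 : ∀ n → par (c₃ (24 * n + 3)) ≡ ψ n
c₃-24n+3 n = ≡.trans (c₃-at-4m (24 * n + 3) (1 + n * 2 * 3) (exp n)) (≡.trans (A-at-3n+1 (n * 2)) (B-at-even n))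
  where
  exp : ∀ n → suc (24 * n + 3) ≡ (1 + n * 2 * 3) * 2 * 2
  exp = solve-∀

c₃-12n+3 : ∀ n → par (c₃ (12 * n + 3)) ≡ B n
c₃-12n+3 n = ≡.trans (c₃-at-4m (12 * n + 3) (1 + n * 3) (exp n)) (A-at-3n+1 n)
  where
  exp : ∀ n → suc (12 * n + 3) ≡ (1 + n * 3) * 2 * 2
  exp = solve-∀

-- The index plus one is 4(1 + 3(1 + 2n)), which leads to an odd index of `B`. The shift from n + 1
-- to n matches the factor q in ψ₆ = q C.
c₃-24n-9 : ∀ n → par (c₃ (24 * suc n ∸ 9)) ≡ C n
c₃-24n-9 n = ≡.trans
  (c₃-at-4m (24 * suc n ∸ 9) (1 + (1 + n * 2) * 3) (≡.trans (cong (λ k → suc (k ∸ 9)) (exp₁ n)) (exp₂ n)))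
  (≡.trans (A-at-3n+1 (1 + n * 2)) (B-at-odd n))
  where
  exp₁ : ∀ n → 24 * suc n ≡ 9 + (15 + 24 * n)
  exp₁ = solve-∀
  exp₂ : ∀ n → suc (15 + 24 * n) ≡ (1 + (1 + n * 2) * 3) * 2 * 2
  exp₂ = solve-∀

par-ψ₆ : ∀ n → par (ψ₆ (suc n)) ≡ C n
par-ψ₆ n = ≡.trans (at (reduces red-ψ₆) (suc n)) (X·-at-suc C n)

par-twoμ₆ : ∀ n → par (twoμ₆ (2 * n)) ≡ r n
par-twoμ₆ n = ≡.trans (at (reduces red-twoμ₆) (2 * n)) (r²-at-even n)

-- The congruences between integers

hauptmoduln-agree : ∀ n → 1 ≤ n → (c₃ n ≡₂ c₆ n) × (c₆ n ≡₂ c₁₂ n)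
hauptmoduln-agree n 1≤n = ≡₂-from (c₃ n) (c₆ n) (par-c₃ n) (par-c₆ n 1≤n) , ≡₂-from (c₆ n) (c₁₂ n) (par-c₆ n 1≤n) (par-c₁₂ n)

c₃-even-classes : ∀ n → (c₃ (4 * n + 1) ≡₂ 0ℤ) × (c₃ (12 * n + 7) ≡₂ 0ℤ) × (c₃ (24 * n + 11) ≡₂ 0ℤ)
c₃-even-classes n = ≡₂-from (c₃ (4 * n + 1)) 0ℤ (c₃-4n+1 n) ≡.refl
        , ≡₂-from (c₃ (12 * n + 7)) 0ℤ (c₃-12n+7 n) ≡.refl
        , ≡₂-from (c₃ (24 * n + 11)) 0ℤ (c₃-24n+11 n) ≡.refl

c₃-partition-class : ∀ n → 1 ≤ n → (c₃ (24 * n ∸ 1) ≡₂ f₃ n) × (f₃ n ≡₂ φ₃ n) × (φ₃ n ≡₂ φ₆ n)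
                    × (φ₆ n ≡₂ twoμ₆ (2 * n)) × (twoμ₆ (2 * n) ≡₂ + p n)
c₃-partition-class n 1≤n = ≡₂-from (c₃ (24 * n ∸ 1)) (f₃ n) (c₃-24n-1 n 1≤n) (at (reduces red-f₃) n)
            , ≡₂-from (f₃ n) (φ₃ n) (at (reduces red-f₃) n) (at (reduces red-φ₃) n)
            , ≡₂-from (φ₃ n) (φ₆ n) (at (reduces red-φ₃) n) (at (reduces red-φ₆) n)
            , ≡₂-from (φ₆ n) (twoμ₆ (2 * n)) (at (reduces red-φ₆) n) (par-twoμ₆ n)
            , ≡₂-from (twoμ₆ (2 * n)) (+ p n) (par-twoμ₆ n) (parity-p n)

c₃-ψ₆-class : ∀ n → 1 ≤ n → c₃ (24 * n ∸ 9) ≡₂ ψ₆ n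
c₃-ψ₆-class (suc n) _ = ≡₂-from (c₃ (24 * suc n ∸ 9)) (ψ₆ (suc n)) (c₃-24n-9 n) (par-ψ₆ n)

odd⇒triangular : ∀ n → c₃ (24 * n + 3) ≡₂ 1ℤ → ∃ (λ k → n ≡ (k * (k + 1)) / 2)
odd⇒triangular n odd = triangular (ψ-support n (≡.trans (≡.sym (c₃-24n+3 n)) (≡₂⇒par (c₃ (24 * n + 3)) 1ℤ odd)))
  where
  triangular : (∃ λ k → n ≡ T k) → ∃ (λ k → n ≡ (k * (k + 1)) / 2)
  triangular (k , eq) = k , ≡.trans eq (T≡k[k+1]/2 k)

triangular⇒odd : ∀ n → ∃ (λ k → n ≡ (k * (k + 1)) / 2) → c₃ (24 * n + 3) ≡₂ 1ℤ
triangular⇒odd n (k , eq) = ≡₂-from (c₃ (24 * n + 3)) 1ℤ {1ℙ} c₃-odd ≡.refl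
  where
  c₃-odd : par (c₃ (24 * n + 3)) ≡ 1ℙ
  c₃-odd = ≡.trans (c₃-24n+3 n) (≡.trans (cong ψ (≡.trans eq (≡.sym (T≡k[k+1]/2 k)))) (ψ-at-T k))

theorem1p2 : (∀ n → 1 ≤ n → (c₃ n ≡₂ c₆ n) × (c₆ n ≡₂ c₁₂ n))
    × ((∀ n → 1 ≤ n → c₃ (2 * n) ≡₂ 0ℤ)
    × (∀ n → (c₃ (4 * n + 1) ≡₂ 0ℤ) × (c₃ (12 * n + 7) ≡₂ 0ℤ) × (c₃ (24 * n + 11) ≡₂ 0ℤ)))
    × (∀ n → 1 ≤ n →
    (c₃ (24 * n ∸ 1) ≡₂ f₃ n) × (f₃ n ≡₂ φ₃ n) × (φ₃ n ≡₂ φ₆ n)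
    × (φ₆ n ≡₂ twoμ₆ (2 * n)) × (twoμ₆ (2 * n) ≡₂ + p n))
    × (∀ n → 1 ≤ n → c₃ (24 * n ∸ 9) ≡₂ ψ₆ n)
    × (∀ n → (c₃ (24 * n + 3) ≡₂ 1ℤ) ⇔ ∃ (λ k → n ≡ (k * (k + 1)) / 2))
    × (∀ n → c₃ (12 * n + 3) ≡₂ λ₆ n)
theorem1p2 =
    hauptmoduln-agree
  , ((λ n _ → ≡₂-from (c₃ (2 * n)) 0ℤ (c₃-2n n) ≡.refl) , c₃-even-classes)
  , c₃-partition-class
  , c₃-ψ₆-class
  , (λ n → mk⇔ (odd⇒triangular n) (triangular⇒odd n))
  , (λ n → ≡₂-from (c₃ (12 * n + 3)) (λ₆ n) (c₃-12n+3 n) (at (reduces red-λ₆) n))
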